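{- Let $\mathcal{T}$ be an $\mathcal{ALC}$-TBox and $\Sigma\subseteq\mathsf{sig}(\mathcal{T})$. If there is a uniform $\Sigma$-interpolant of $\mathcal{T}$, then there is one of size at most $2^{2^{2^{p(|\mathcal{T}|)}}}$, where $p$ is a polynomial (independent of $\mathcal{T}$ and $\Sigma$).
   Context: $\mathcal{ALC}$-concepts over disjoint countably infinite sets $N_C$, $N_R$ of concept and role names: $C::=\top\mid A\mid\neg C\mid C\sqcap D\mid\exists r.C$ with standard semantics. A TBox is a finite set of concept inclusions; its size $|\mathcal{T}|$ is its length (number of symbols needed to write it); $\mathsf{sig}$ is the set of names occurring. A TBox $\mathcal{T}'$ is a uniform $\Sigma$-interpolant of $\mathcal{T}$ if $\mathsf{sig}(\mathcal{T}')\subseteq\Sigma\subseteq\mathsf{sig}(\mathcal{T})$ and for all inclusions $C\sqsubseteq D$ using only names from $\Sigma$: $\mathcal{T}\models C\sqsubseteq D$ iff $\mathcal{T}'\models C\sqsubseteq D$. -}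

module Defs where

open import Data.Nat using (ℕ; zero; suc; _+_; _*_; _^_; _≤_)
open import Data.List using (List; []; _∷_)
open import Data.List.Membership.Propositional using (_∈_)
open import Data.List.Relation.Unary.All using (All)
open import Data.Product using (Σ; _×_; _,_; ∃)
open import Data.Sum using (_⊎_)
open import Data.Empty using (⊥)
open import Data.Unit using (⊤)
open import Relation.Nullary using (¬_)
open import Function.Bundles using (_⇔_)
open import Relation.Binary.PropositionalEquality using (_≡_)

-- Concept names and role names: N_C = ℕ, N_R = ℕ (disjoint, countably infinite).
CName : Set
CName = ℕ

RName : Set
RName = ℕ

data Concept : Set where
  top  : Concept
  atom : CName → Concept
  neg  : Concept → Concept
  and  : Concept → Concept → Concept
  ex   : RName → Concept → Concept

record CI : Set where
  constructor _⊑_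
  field
    lhs : Concept
    rhs : Concept

TBox : Set
TBox = List CI

-- Size = number of symbols needed to write it.
-- ⊤, A : 1 symbol; ¬C : 1 + |C|; C ⊓ D : 1 + |C| + |D|; ∃r.C : 2 + |C| (∃ and r);
-- C ⊑ D : |C| + 1 + |D|.
sizeC : Concept → ℕ
sizeC top       = 1
sizeC (atom _)  = 1
sizeC (neg c)   = suc (sizeC c)
sizeC (and c d) = suc (sizeC c + sizeC d)
sizeC (ex _ c)  = 2 + sizeC c

sizeCI : CI → ℕ
sizeCI (c ⊑ d) = sizeC c + suc (sizeC d)

sizeT : TBox → ℕ
sizeT []       = 0
sizeT (i ∷ is) = sizeCI i + sizeT is

CNameInC : CName → Concept → Set
CNameInC a top       = ⊥
CNameInC a (atom b)  = a ≡ b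
CNameInC a (neg c)   = CNameInC a c
CNameInC a (and c d) = CNameInC a c ⊎ CNameInC a d
CNameInC a (ex _ c)  = CNameInC a c

RNameInC : RName → Concept → Set
RNameInC r top       = ⊥
RNameInC r (atom _)  = ⊥
RNameInC r (neg c)   = RNameInC r c
RNameInC r (and c d) = RNameInC r c ⊎ RNameInC r d
RNameInC r (ex s c)  = (r ≡ s) ⊎ RNameInC r c

CNameInT : CName → TBox → Set
CNameInT a t = ∃ λ i → i ∈ t × (CNameInC a (CI.lhs i) ⊎ CNameInC a (CI.rhs i))

RNameInT : RName → TBox → Set
RNameInT r t = ∃ λ i → i ∈ t × (RNameInC r (CI.lhs i) ⊎ RNameInC r (CI.rhs i))

record Sig : Set where
  field
    cnames : List CName
    rnames : List RName

SigSub : Sig → TBox → Set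
SigSub s t = All (λ a → CNameInT a t) (Sig.cnames s) × All (λ r → RNameInT r t) (Sig.rnames s)

ConceptOver : Sig → Concept → Set
ConceptOver s top       = ⊤
ConceptOver s (atom a)  = a ∈ Sig.cnames s
ConceptOver s (neg c)   = ConceptOver s c
ConceptOver s (and c d) = ConceptOver s c × ConceptOver s d
ConceptOver s (ex r c)  = r ∈ Sig.rnames s × ConceptOver s c

TBoxOver : Sig → TBox → Set
TBoxOver s t = All (λ i → ConceptOver s (CI.lhs i) × ConceptOver s (CI.rhs i)) t

record Interp : Set₁ where
  field
    Δ    : Set
    pt   : Δ
    conc : CName → Δ → Set
    role : RName → Δ → Δ → Set

ext : (I : Interp) → Concept → Interp.Δ I → Set
ext I top       x = ⊤
ext I (atom a)  x = Interp.conc I a x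
ext I (neg c)   x = ¬ ext I c x
ext I (and c d) x = ext I c x × ext I d x
ext I (ex r c)  x = Σ (Interp.Δ I) λ y → Interp.role I r x y × ext I c y

SatCI : Interp → CI → Set
SatCI I (c ⊑ d) = (x : Interp.Δ I) → ext I c x → ext I d x

Model : Interp → TBox → Set
Model I t = All (SatCI I) t

Entails : TBox → CI → Set₁
Entails t i = (I : Interp) → Model I t → SatCI I i

-- T' is a uniform Σ-interpolant of T
-- (the condition Σ ⊆ sig(T) is stated separately as a hypothesis)
UniformInterpolant : Sig → TBox → TBox → Set₁
UniformInterpolant s t t' =
  TBoxOver s t' ×
  ((c d : Concept) → ConceptOver s c → ConceptOver s d →
     (Entails t (c ⊑ d) ⇔ Entails t' (c ⊑ d)))

-- Polynomials with natural-number coefficients (constant term first)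
Poly : Set
Poly = List ℕ

evalP : Poly → ℕ → ℕ
evalP []       n = 0
evalP (a ∷ as) n = a + n * evalP as n

{-# OPTIONS --safe #-}
module Submission where

-- Let χ k t be the Σ-concept describing, up to role depth k, the points that can
-- have type t in a model of T, and let T_k say that every point satisfies some
-- χ k t.  Always T entails T_k, and unravelling a model of T_k into a model of T
-- shows that T_k has all Σ-consequences of T of depth at most k.  Hence if an
-- interpolant of depth N exists, then T_N entails every T_n.  Writing Ext x for
-- the set of types compatible with x at all depths, the sets of pairs
-- (Ext x , Ext y) with x and y m-bisimilar and every Ext in sight nonempty
-- decrease in m, each being determined by its predecessor; so they stabilise at
-- some M bounded by the number of pairs, which is doubly exponential.  From then
-- on M-bisimilarity is as good as N-bisimilarity for propagating nonemptiness of
-- Ext, which makes T_(M+1) an interpolant; its size is exponential in M.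

open import Defs
open import Level using (0ℓ)
open import Axiom.ExcludedMiddle using (ExcludedMiddle)
open import Data.Nat using (ℕ; zero; suc; _+_; _*_; _^_; _≤_; _<_; _⊔_; z≤n; s≤s;
  NonZero; >-nonZero; _≤′_; ≤′-refl; ≤′-step)
open import Data.Nat.Properties
open import Data.Nat.Solver using (module +-*-Solver)
open import Data.Fin using (Fin; toℕ)
open import Data.Fin.Properties using (pigeonhole; toℕ≤pred[n])
open import Data.List using (List; []; _∷_; _++_; map; filter; length; lookup; upTo; cartesianProduct)
open import Data.List.Properties using (length-map; map-∘; length-++; length-filter)
open import Data.List.Membership.Propositional using (_∈_)
open import Data.List.Membership.Propositional.Properties
open import Data.List.Relation.Unary.All as All using (All)
open import Data.List.Relation.Unary.Any as Any using (here; there)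
open import Data.List.Relation.Unary.Any.Properties using (lookup-index)
open import Data.Product using (Σ; _×_; _,_; ∃; ∃₂; proj₁; proj₂)
open import Data.Sum using (inj₁; inj₂)
open import Data.Empty using (⊥-elim)
open import Data.Unit using (⊤; tt)
open import Function using (_∘_; id)
open import Function.Bundles using (_⇔_; mk⇔; Equivalence)
open import Relation.Nullary using (¬_; yes; no)
open import Relation.Binary.PropositionalEquality using (_≡_; refl; sym; trans; cong; cong₂; subst)
open import Relation.Binary.Construct.Closure.ReflexiveTransitive using (Star; ε; _◅_; _◅◅_)

open Equivalence using (to; from)
open Interp

-- Equivalences, sublists and their number.

⇔-sym : {P Q : Set} → P ⇔ Q → Q ⇔ P
⇔-sym e = mk⇔ (from e) (to e)

infixr 4 _⇔∘_
_⇔∘_ : {P Q R : Set} → P ⇔ Q → Q ⇔ R → P ⇔ R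
e ⇔∘ f = mk⇔ (to f ∘ to e) (from e ∘ from f)

sublists : {A : Set} → List A → List (List A)
sublists []       = [] ∷ []
sublists (x ∷ xs) = map (x ∷_) (sublists xs) ++ sublists xs

length-sublists : {A : Set} (xs : List A) → length (sublists xs) ≡ 2 ^ length xs
length-sublists []       = refl
length-sublists (x ∷ xs) = trans (length-++ (map (x ∷_) (sublists xs)))
  (cong₂ _+_ (trans (length-map _ (sublists xs)) (length-sublists xs))
             (trans (length-sublists xs) (sym (+-identityʳ _))))

length-cartesianProduct : {A B : Set} (xs : List A) (ys : List B) →
  length (cartesianProduct xs ys) ≡ length xs * length ys
length-cartesianProduct []       ys = refl
length-cartesianProduct (x ∷ xs) ys = trans (length-++ (map (x ,_) ys))
  (cong₂ _+_ (length-map _ ys) (length-cartesianProduct xs ys))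

⊆-sublists : {A : Set} (xs : List A) {ys : List A} {x : A} → ys ∈ sublists xs → x ∈ ys → x ∈ xs
⊆-sublists []       (here refl) ()
⊆-sublists (x ∷ xs) p q with ∈-++⁻ (map (x ∷_) (sublists xs)) p
... | inj₂ p′ = there (⊆-sublists xs p′ q)
... | inj₁ p′ with ∈-map⁻ (x ∷_) p′
...   | zs , r , refl with q
...     | here e   = here e
...     | there q′ = there (⊆-sublists xs r q′)

-- Classical reasoning about finite lists: subsets, choice, stabilisation.

module Classical (em : ExcludedMiddle 0ℓ) where

  byContradiction : {P : Set} → ¬ ¬ P → P
  byContradiction {P} f with em {P}
  ... | yes p = p
  ... | no ¬p = ⊥-elim (f ¬p)

  keep : {A : Set} → (A → Set) → List A → List A
  keep P = filter (λ x → em {P x})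

  keep⁺ : {A : Set} (P : A → Set) {xs : List A} {x : A} → x ∈ xs → P x → x ∈ keep P xs
  keep⁺ P = ∈-filter⁺ (λ x → em {P x})

  keep⁻ : {A : Set} (P : A → Set) {xs : List A} {x : A} → x ∈ keep P xs → x ∈ xs × P x
  keep⁻ P = ∈-filter⁻ (λ x → em {P x})

  -- Filtering preserves the order of `xs`, so every predicate is represented by one canonical list
  -- among the `2 ^ length xs` sublists. Sets of subconcepts and sets of types are counted this way.
  keep-∈-sublists : {A : Set} (P : A → Set) (xs : List A) → keep P xs ∈ sublists xs
  keep-∈-sublists P []       = here refl
  keep-∈-sublists P (x ∷ xs) with em {P x}
  ... | yes _ = ∈-++⁺ˡ (∈-map⁺ (x ∷_) (keep-∈-sublists P xs))
  ... | no  _ = ∈-++⁺ʳ (map (x ∷_) (sublists xs)) (keep-∈-sublists P xs)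

  -- Finite choice. The first property says that nothing required is missed, the second that nothing
  -- else is added; child lists of new trees are built with it.
  collect : {A B : Set} (P : A → Set) (R : A → B → Set) (xs : List A) →
    (∀ {x} → x ∈ xs → P x → ∃ (R x)) →
    ∃ λ ys → (∀ {x} → x ∈ xs → P x → ∃ λ y → y ∈ ys × R x y)
           × (∀ {y} → y ∈ ys → ∃ λ x → x ∈ xs × P x × R x y)
  collect P R []       f = [] , (λ ()) , (λ ())
  collect P R (x ∷ xs) f with collect P R xs (f ∘ there) | em {P x}
  ... | ys , g , h | no ¬p = ys
    , (λ { (here refl) p → ⊥-elim (¬p p) ; (there q) p → g q p })
    , λ q → let z , z∈ , rest = h q in z , there z∈ , rest
  ... | ys , g , h | yes p = y ∷ ys
    , (λ { (here refl) _ → y , here refl , r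
         ; (there q) p′ → let z , z∈ , s = g q p′ in z , there z∈ , s })
    , λ { (here refl) → x , here refl , p , r
        ; (there q) → let z , z∈ , rest = h q in z , there z∈ , rest }
    where
    y = proj₁ (f (here refl) p)
    r = proj₂ (f (here refl) p)

  -- Splitting `Q` on one index after another leaves finitely many cells, and one point is chosen
  -- from each inhabited cell.
  representatives : {D I : Set} (P : I → D → Set) (is : List I) (Q : D → Set) →
    ∃ λ vs → ∀ {x} → Q x → ∃ λ v → v ∈ vs × Q v × (∀ {i} → i ∈ is → P i x ⇔ P i v)
  representatives P [] Q with em {∃ Q}
  ... | yes (v , q) = v ∷ [] , λ _ → v , here refl , q , λ ()
  ... | no ¬q       = [] , λ q → ⊥-elim (¬q (_ , q))
  representatives {D} P (i ∷ is) Q = proj₁ with-i ++ proj₁ without-i , covers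
    where
    with-i    = representatives P is (λ x → Q x × P i x)
    without-i = representatives P is (λ x → Q x × ¬ P i x)
    covers : ∀ {x} → Q x → ∃ λ v → v ∈ proj₁ with-i ++ proj₁ without-i × Q v
      × (∀ {j} → j ∈ i ∷ is → P j x ⇔ P j v)
    covers {x} q with em {P i x}
    ... | yes p = let v , v∈ , (qv , pv) , same = proj₂ with-i (q , p) in
      v , ∈-++⁺ˡ v∈ , qv , λ { (here refl) → mk⇔ (λ _ → pv) (λ _ → p) ; (there j) → same j }
    ... | no ¬p = let v , v∈ , (qv , ¬pv) , same = proj₂ without-i (q , ¬p) in
      v , ∈-++⁺ʳ (proj₁ with-i) v∈ , qv
        , λ { (here refl) → mk⇔ (⊥-elim ∘ ¬p) (⊥-elim ∘ ¬pv) ; (there j) → same j }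

  -- Each element of the list either drops out at some level or never does; the maximum of these
  -- finitely many levels works for all of them.
  antitone-stabilises : {A : Set} (P : ℕ → A → Set) →
    (∀ {m n a} → m ≤ n → P n a → P m a) → (xs : List A) →
    ∃ λ m → ∀ {a} → a ∈ xs → P m a → ∀ n → P n a
  antitone-stabilises P anti []       = 0 , λ ()
  antitone-stabilises P anti (x ∷ xs) with antitone-stabilises P anti xs | em {∃ λ m → ¬ P m x}
  ... | m , f | yes (k , ¬p) = m ⊔ k
    , λ { (here refl) p → ⊥-elim (¬p (anti (m≤n⊔m m k) p)) ; (there q) p → f q (anti (m≤m⊔n m k) p) }
  ... | m , f | no all = m
    , λ { (here refl) _ n → byContradiction (λ ¬p → all (n , ¬p)) ; (there q) p → f q p }

  pigeonhole-∈ : {A : Set} (xs : List A) (f : Fin (suc (length xs)) → A) → (∀ i → f i ∈ xs) →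
    ∃₂ λ i j → toℕ i < toℕ j × f i ≡ f j
  pigeonhole-∈ xs f f∈ with pigeonhole (n<1+n (length xs)) (Any.index ∘ f∈)
  ... | i , j , i<j , e = i , j , i<j
    , trans (lookup-index (f∈ i)) (trans (cong (lookup xs) e) (sym (lookup-index (f∈ j))))

-- Atomic and existential subconcepts of a TBox.

modals : Concept → List Concept
modals top       = []
modals (atom a)  = atom a ∷ []
modals (neg c)   = modals c
modals (and c d) = modals c ++ modals d
modals (ex r c)  = ex r c ∷ modals c

-- Ensures that the filler of an existential in the closure is itself evaluated by types over that
-- closure.
modals-closed : ∀ c {r d e} → ex r d ∈ modals c → e ∈ modals d → e ∈ modals c
modals-closed (atom _)  (here ())
modals-closed (neg c)   p q = modals-closed c p q
modals-closed (and c d) p q with ∈-++⁻ (modals c) p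
... | inj₁ p′ = ∈-++⁺ˡ (modals-closed c p′ q)
... | inj₂ p′ = ∈-++⁺ʳ (modals c) (modals-closed d p′ q)
modals-closed (ex r c)  (here refl) q = there q
modals-closed (ex r c)  (there p) q = there (modals-closed c p q)

CName-modal : ∀ c {a} → CNameInC a c → atom a ∈ modals c
CName-modal (atom b)  refl     = here refl
CName-modal (neg c)   p        = CName-modal c p
CName-modal (and c d) (inj₁ p) = ∈-++⁺ˡ (CName-modal c p)
CName-modal (and c d) (inj₂ p) = ∈-++⁺ʳ (modals c) (CName-modal d p)
CName-modal (ex r c)  p        = there (CName-modal c p)

RName-modal : ∀ c {r} → RNameInC r c → ∃ λ d → ex r d ∈ modals c
RName-modal (neg c)   p           = RName-modal c p
RName-modal (and c d) (inj₁ p)    = let e , q = RName-modal c p in e , ∈-++⁺ˡ q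
RName-modal (and c d) (inj₂ p)    = let e , q = RName-modal d p in e , ∈-++⁺ʳ (modals c) q
RName-modal (ex r c)  (inj₁ refl) = c , here refl
RName-modal (ex r c)  (inj₂ p)    = let e , q = RName-modal c p in e , there q

length-modals : ∀ c → length (modals c) ≤ sizeC c
length-modals top       = z≤n
length-modals (atom _)  = ≤-refl
length-modals (neg c)   = m≤n⇒m≤1+n (length-modals c)
length-modals (and c d) = ≤-trans (≤-reflexive (length-++ (modals c)))
  (m≤n⇒m≤1+n (+-mono-≤ (length-modals c) (length-modals d)))
length-modals (ex r c)  = s≤s (m≤n⇒m≤1+n (length-modals c))

modalsCI : CI → List Concept
modalsCI (c ⊑ d) = modals c ++ modals d

modalsT : TBox → List Concept
modalsT []       = []
modalsT (i ∷ is) = modalsCI i ++ modalsT is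

modalsT-∈ : ∀ t {i} → i ∈ t → ∀ {e} → e ∈ modalsCI i → e ∈ modalsT t
modalsT-∈ (i ∷ is) (here refl) q = ∈-++⁺ˡ q
modalsT-∈ (i ∷ is) (there p)   q = ∈-++⁺ʳ (modalsCI i) (modalsT-∈ is p q)

modalsT-closed : ∀ t {r d e} → ex r d ∈ modalsT t → e ∈ modals d → e ∈ modalsT t
modalsT-closed ((c ⊑ d) ∷ is) p q with ∈-++⁻ (modals c ++ modals d) p
... | inj₂ p′ = ∈-++⁺ʳ (modals c ++ modals d) (modalsT-closed is p′ q)
... | inj₁ p′ with ∈-++⁻ (modals c) p′
...   | inj₁ p″ = ∈-++⁺ˡ (∈-++⁺ˡ (modals-closed c p″ q))
...   | inj₂ p″ = ∈-++⁺ˡ (∈-++⁺ʳ (modals c) (modals-closed d p″ q))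

length-modalsT : ∀ t → length (modalsT t) ≤ sizeT t
length-modalsT []             = z≤n
length-modalsT ((c ⊑ d) ∷ is) = begin
  length ((modals c ++ modals d) ++ modalsT is)
    ≡⟨ length-++ (modals c ++ modals d) ⟩
  length (modals c ++ modals d) + length (modalsT is)
    ≡⟨ cong (_+ length (modalsT is)) (length-++ (modals c)) ⟩
  length (modals c) + length (modals d) + length (modalsT is)
    ≤⟨ +-mono-≤ (+-mono-≤ (length-modals c) (m≤n⇒m≤1+n (length-modals d))) (length-modalsT is) ⟩
  sizeC c + suc (sizeC d) + sizeT is ∎
  where open ≤-Reasoning

CName-modalT : ∀ t {a} → CNameInT a t → atom a ∈ modalsT t
CName-modalT t ((c ⊑ d) , i∈ , inj₁ p) = modalsT-∈ t i∈ (∈-++⁺ˡ (CName-modal c p))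
CName-modalT t ((c ⊑ d) , i∈ , inj₂ p) = modalsT-∈ t i∈ (∈-++⁺ʳ (modals c) (CName-modal d p))

RName-modalT : ∀ t {r} → RNameInT r t → ∃ λ d → ex r d ∈ modalsT t
RName-modalT t ((c ⊑ d) , i∈ , inj₁ p) = let e , q = RName-modal c p in
  e , modalsT-∈ t i∈ (∈-++⁺ˡ q)
RName-modalT t ((c ⊑ d) , i∈ , inj₂ p) = let e , q = RName-modal d p in
  e , modalsT-∈ t i∈ (∈-++⁺ʳ (modals c) q)

-- A type is the list of those modal subconcepts that hold at a point; the
-- truth values of all other subconcepts are determined by them.
Type : Set
Type = List Concept

Eval : Type → Concept → Set
Eval t top       = ⊤
Eval t (atom a)  = atom a ∈ t
Eval t (neg c)   = ¬ Eval t c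
Eval t (and c d) = Eval t c × Eval t d
Eval t (ex r c)  = ex r c ∈ t

depth : Concept → ℕ
depth top       = 0
depth (atom _)  = 0
depth (neg c)   = depth c
depth (and c d) = depth c ⊔ depth d
depth (ex r c)  = suc (depth c)

depthT : TBox → ℕ
depthT []             = 0
depthT ((c ⊑ d) ∷ is) = (depth c ⊔ depth d) ⊔ depthT is

depthT-∈ : ∀ t {c d} → (c ⊑ d) ∈ t → depth c ≤ depthT t × depth d ≤ depthT t
depthT-∈ ((c ⊑ d) ∷ is) (here refl) =
    ≤-trans (m≤m⊔n (depth c) (depth d)) (m≤m⊔n _ (depthT is))
  , ≤-trans (m≤n⊔m (depth c) (depth d)) (m≤m⊔n _ (depthT is))
depthT-∈ ((c ⊑ d) ∷ is) (there p) = let l , r = depthT-∈ is p in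
  ≤-trans l (m≤n⊔m _ (depthT is)) , ≤-trans r (m≤n⊔m _ (depthT is))

-- A tree stands for a finitely branching pointed interpretation: leaf t is a
-- point of type t in the canonical model of the TBox, whose points are all
-- realisable types.
data Tree : Set where
  leaf : Type → Tree
  node : Type → List (RName × Tree) → Tree

label : Tree → Type
label (leaf t)   = t
label (node t _) = t

module Unfolding (em : ExcludedMiddle 0ℓ) (T : TBox) (S : Sig) (sig : SigSub S T) where

  open Classical em

  cn : List CName
  cn = Sig.cnames S

  rn : List RName
  rn = Sig.rnames S

  cl : List Concept
  cl = modalsT T

  cn-cl : ∀ {a} → a ∈ cn → atom a ∈ cl
  cn-cl a∈ = CName-modalT T (All.lookup (proj₁ sig) a∈)

  rn-cl : ∀ {r} → r ∈ rn → ∃ λ d → ex r d ∈ cl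
  rn-cl r∈ = RName-modalT T (All.lookup (proj₂ sig) r∈)

  -- Type elimination and truth lemmas.

  Compatible : RName → Type → Type → Set
  Compatible r t t′ = ∀ {d} → ex r d ∈ cl → Eval t′ d → ex r d ∈ t

  record Closed (Z : List Type) (t : Type) : Set where
    field
      within  : t ∈ sublists cl
      local   : ∀ {c d} → (c ⊑ d) ∈ T → Eval t c → Eval t d
      witness : ∀ {r d} → ex r d ∈ t → ∃ λ t′ → t′ ∈ Z × Compatible r t t′ × Eval t′ d
  open Closed

  -- The greatest fixed point of type elimination, presented as the union of the finite sets `Z`
  -- that survive it.
  Realisable : Type → Set
  Realisable t = ∃ λ Z → t ∈ Z × (∀ {t′} → t′ ∈ Z → Closed Z t′)

  types : List Type
  types = keep Realisable (sublists cl)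

  types⁺ : ∀ {t} → Realisable t → t ∈ types
  types⁺ R@(Z , t∈ , closed) = keep⁺ Realisable (within (closed t∈)) R

  types-⊆ : ∀ {t d} → t ∈ types → d ∈ t → d ∈ cl
  types-⊆ p = ⊆-sublists cl (proj₁ (keep⁻ Realisable {sublists cl} p))

  types-local : ∀ {t c d} → t ∈ types → (c ⊑ d) ∈ T → Eval t c → Eval t d
  types-local p = let _ , t∈ , closed = proj₂ (keep⁻ Realisable {sublists cl} p) in local (closed t∈)

  types-witness : ∀ {t r d} → t ∈ types → ex r d ∈ t →
    ∃ λ t′ → t′ ∈ types × Compatible r t t′ × Eval t′ d
  types-witness p q =
    let Z , t∈ , closed  = proj₂ (keep⁻ Realisable {sublists cl} p)
        t′ , t′∈ , comp , ev = witness (closed t∈) q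
    in t′ , types⁺ (Z , t′∈ , closed) , comp , ev

  record Typing (I : Interp) : Set where
    field
      τ         : Δ I → Type
      real      : ∀ x → τ x ∈ types
      atoms     : ∀ {a} x → atom a ∈ cl → conc I a x ⇔ atom a ∈ τ x
      compat    : ∀ {r x y} → role I r x y → Compatible r (τ x) (τ y)
      succ      : ∀ {r d} x → ex r d ∈ τ x → ∃ λ y → role I r x y × Eval (τ y) d

  module _ {I : Interp} (ty : Typing I) where
    open Typing ty

    -- At an existential, `compat` turns a successor into membership in the type and `succ` turns
    -- membership into a successor.
    truth : ∀ c → (∀ {d} → d ∈ modals c → d ∈ cl) → ∀ x → ext I c x ⇔ Eval (τ x) c
    truth top       s x = mk⇔ id id
    truth (atom a)  s x = atoms x (s (here refl))
    truth (neg c)   s x = let e = truth c s x in mk⇔ (_∘ from e) (_∘ to e)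
    truth (and c d) s x =
      let e = truth c (s ∘ ∈-++⁺ˡ) x
          f = truth d (s ∘ ∈-++⁺ʳ (modals c)) x
      in mk⇔ (λ (p , q) → to e p , to f q) (λ (p , q) → from e p , from f q)
    truth (ex r c)  s x = mk⇔
      (λ (y , xy , p) → compat xy (s (here refl)) (to (truth c (s ∘ there) y) p))
      (λ p → let y , xy , q = succ x p in y , xy , from (truth c (s ∘ there) y) q)

    typing-model : Model I T
    typing-model = All.tabulate λ { {c ⊑ d} i∈ x p →
      from (truth d (modalsT-∈ T i∈ ∘ ∈-++⁺ʳ (modals c)) x)
        (types-local (real x) i∈ (to (truth c (modalsT-∈ T i∈ ∘ ∈-++⁺ˡ) x) p)) }

  module _ {I : Interp} (mod : Model I T) where

    tp : Δ I → Type
    tp x = keep (λ d → ext I d x) cl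

    truth-tp : ∀ c → (∀ {d} → d ∈ modals c → d ∈ cl) → ∀ x → ext I c x ⇔ Eval (tp x) c
    truth-tp top       s x = mk⇔ id id
    truth-tp (atom a)  s x = mk⇔ (keep⁺ (λ d → ext I d x) (s (here refl)))
                                 (proj₂ ∘ keep⁻ (λ d → ext I d x) {cl})
    truth-tp (neg c)   s x = let e = truth-tp c s x in mk⇔ (_∘ from e) (_∘ to e)
    truth-tp (and c d) s x =
      let e = truth-tp c (s ∘ ∈-++⁺ˡ) x
          f = truth-tp d (s ∘ ∈-++⁺ʳ (modals c)) x
      in mk⇔ (λ (p , q) → to e p , to f q) (λ (p , q) → from e p , from f q)
    truth-tp (ex r c)  s x = mk⇔ (keep⁺ (λ d → ext I d x) (s (here refl)))
                                 (proj₂ ∘ keep⁻ (λ d → ext I d x) {cl})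

    -- The set `Z` of all types occurring in the model is closed under witnesses, which makes each
    -- of them realisable.
    tp-typing : Typing I
    tp-typing = record
      { τ      = tp
      ; real   = λ x → types⁺ (Z , in-Z x , λ t∈ → closed (proj₂ (keep⁻ Occurs {sublists cl} t∈)))
      ; atoms  = λ {a} x a∈ → truth-tp (atom a) (λ { (here refl) → a∈ }) x
      ; compat = compatible
      ; succ   = λ x p → successor p
      }
      where
      Occurs : Type → Set
      Occurs t = ∃ λ x → t ≡ tp x
      Z : List Type
      Z = keep Occurs (sublists cl)
      in-Z : ∀ x → tp x ∈ Z
      in-Z x = keep⁺ Occurs (keep-∈-sublists _ cl) (x , refl)
      compatible : ∀ {r x y} → role I r x y → Compatible r (tp x) (tp y)
      compatible {r} {x} {y} xy {d} d∈ ev =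
        keep⁺ (λ d → ext I d x) d∈ (y , xy , from (truth-tp d (modalsT-closed T d∈) y) ev)
      successor : ∀ {x r d} → ex r d ∈ tp x → ∃ λ y → role I r x y × Eval (tp y) d
      successor {x} {r} {d} p =
        let d∈ , y , xy , q = keep⁻ (λ d → ext I d x) {cl} p
        in y , xy , to (truth-tp d (modalsT-closed T d∈) y) q
      closed : ∀ {t} → Occurs t → Closed Z t
      closed (x , refl) = record
        { within  = keep-∈-sublists _ cl
        ; local   = λ { {c} {d} i∈ p →
            to (truth-tp d (modalsT-∈ T i∈ ∘ ∈-++⁺ʳ (modals c)) x)
              (All.lookup mod i∈ x (from (truth-tp c (modalsT-∈ T i∈ ∘ ∈-++⁺ˡ) x) p)) }
        ; witness = λ p → let y , xy , q = successor p in tp y , in-Z y , compatible xy , q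
        }

  -- Approximate types of a point and bounded Σ-bisimilarity.

  Literals : (I : Interp) → Δ I → Type → Set
  Literals I x t = ∀ a → a ∈ cn → conc I a x ⇔ atom a ∈ t

  -- Only roles in Σ are constrained: witnesses along other roles come from realisability of `t` and
  -- may be placed outside `I`.
  record Step (I : Interp) (P : Δ I → Type → Set) (x : Δ I) (t : Type) : Set where
    constructor step
    field
      real   : t ∈ types
      lits   : Literals I x t
      box    : ∀ {r y} → r ∈ rn → role I r x y → ∃ λ t′ → Compatible r t t′ × P y t′
      dia    : ∀ {r d} → r ∈ rn → ex r d ∈ t →
               ∃ λ y → role I r x y × ∃ λ t′ → Compatible r t t′ × Eval t′ d × P y t′
  open Step

  -- W I k x is the set of types that x could have in a model of T, as far as its
  -- Σ-successors up to depth k tell.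
  W : (I : Interp) → ℕ → Δ I → Type → Set
  W I zero    x t = t ∈ types × Literals I x t
  W I (suc k) x t = Step I (W I k) x t

  W-real : ∀ {I} k {x t} → W I k x t → t ∈ types
  W-real zero    = proj₁
  W-real (suc k) = real

  W-lits : ∀ {I} k {x t} → W I k x t → Literals I x t
  W-lits zero    = proj₂
  W-lits (suc k) = lits

  record Match (I J : Interp) (R : Δ I → Δ J → Set) (x : Δ I) (y : Δ J) : Set where
    constructor match
    field
      same  : ∀ {a} → a ∈ cn → conc I a x ⇔ conc J a y
      forth : ∀ {r x′} → r ∈ rn → role I r x x′ → ∃ λ y′ → role J r y y′ × R x′ y′
      back  : ∀ {r y′} → r ∈ rn → role J r y y′ → ∃ λ x′ → role I r x x′ × R x′ y′
  open Match

  Match-mono : ∀ {I J R R′ x y} → (∀ {x′ y′} → R x′ y′ → R′ x′ y′) →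
    Match I J R x y → Match I J R′ x y
  Match-mono f m .same = same m
  Match-mono f m .forth r∈ e = let y , e′ , p = forth m r∈ e in y , e′ , f p
  Match-mono f m .back  r∈ e = let y , e′ , p = back m r∈ e in y , e′ , f p

  Match-sym : ∀ {I J R x y} → Match I J R x y → Match J I (λ y′ x′ → R x′ y′) y x
  Match-sym m .same a∈ = ⇔-sym (same m a∈)
  Match-sym m .forth = back m
  Match-sym m .back  = forth m

  Step-match : ∀ {I J R} {P : Δ I → Type → Set} {P′ : Δ J → Type → Set} {x y t} →
    Match I J R x y → (∀ {x′ y′ t′} → R x′ y′ → P x′ t′ → P′ y′ t′) →
    Step I P x t → Step J P′ y t
  Step-match m f s .real = real s
  Step-match m f s .lits a a∈ = ⇔-sym (same m a∈) ⇔∘ lits s a a∈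
  Step-match m f s .box r∈ e =
    let x′ , e′ , ρ = back m r∈ e
        t′ , c , p  = box s r∈ e′
    in t′ , c , f ρ p
  Step-match m f s .dia r∈ d∈ =
    let x′ , e , t′ , c , v , p = dia s r∈ d∈
        y′ , e′ , ρ             = forth m r∈ e
    in y′ , e′ , t′ , c , v , f ρ p

  Edge : (I : Interp) → Δ I → Δ I → Set
  Edge I x y = ∃ λ r → r ∈ rn × role I r x y

  -- The identity as a bisimulation step, remembering the edge taken. `Step-match` along it changes
  -- the predicate at the Σ-successors of `x` only.
  Match-refl : ∀ {I x} → Match I I (λ y z → y ≡ z × Edge I x y) x x
  Match-refl .same _ = mk⇔ id id
  Match-refl .forth {r} r∈ e = _ , e , refl , r , r∈ , e
  Match-refl .back  {r} r∈ e = _ , e , refl , r , r∈ , e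

  W-pred : ∀ {I} k {x t} → W I (suc k) x t → W I k x t
  W-pred zero    s = real s , lits s
  W-pred (suc k) s = Step-match Match-refl (λ { (refl , _) → W-pred k }) s

  W-anti : ∀ {I m n x t} → m ≤ n → W I n x t → W I m x t
  W-anti {I} {m} {n} m≤n = go (≤⇒≤′ m≤n)
    where
    go : ∀ {n x t} → m ≤′ n → W I n x t → W I m x t
    go ≤′-refl     w = w
    go (≤′-step p) w = go p (W-pred _ w)

  B : (I J : Interp) → ℕ → Δ I → Δ J → Set
  B I J zero    x y = ∀ {a} → a ∈ cn → conc I a x ⇔ conc J a y
  B I J (suc k) x y = Match I J (B I J k) x y

  B-pred : ∀ {I J} k {x y} → B I J (suc k) x y → B I J k x y
  B-pred zero    m = same m
  B-pred (suc k) m = Match-mono (B-pred k) m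

  B-anti : ∀ {I J m n x y} → m ≤ n → B I J n x y → B I J m x y
  B-anti {I} {J} {m} m≤n = go (≤⇒≤′ m≤n)
    where
    go : ∀ {n x y} → m ≤′ n → B I J n x y → B I J m x y
    go ≤′-refl     b = b
    go (≤′-step p) b = go p (B-pred _ b)

  -- `W` at level `k` looks at Σ-names along at most `k` Σ-edges, which is what `B` at level `k`
  -- preserves.
  B-W : ∀ {I J} k {x y t} → B I J k x y → W I k x t → W J k y t
  B-W zero    b (p , l) = p , λ a a∈ → ⇔-sym (b a∈) ⇔∘ l a a∈
  B-W (suc k) b s       = Step-match b (B-W k) s

  B-join : ∀ {I J K} k {x y z} → B I J k x z → B K J k y z → B I K k x y
  B-join zero    b c a∈ = b a∈ ⇔∘ ⇔-sym (c a∈)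
  B-join (suc k) b c .same a∈ = same b a∈ ⇔∘ ⇔-sym (same c a∈)
  B-join (suc k) b c .forth r∈ e =
    let z′ , e′ , p = forth b r∈ e
        y′ , e″ , q = back c r∈ e′
    in y′ , e″ , B-join k p q
  B-join (suc k) b c .back r∈ e =
    let z′ , e′ , p = forth c r∈ e
        x′ , e″ , q = back b r∈ e′
    in x′ , e″ , B-join k q p

  Satisfies : Interp → ℕ → Set
  Satisfies I k = ∀ x → ∃ (W I k x)

  model-satisfies : ∀ {I} → Model I T → ∀ k → Satisfies I k
  model-satisfies {I} mod k x = tp mod x , go k x
    where
    open Typing (tp-typing mod)
      using () renaming (real to tp-real; atoms to tp-atoms; compat to tp-compat; succ to tp-succ)
    go : ∀ k x → W I k x (tp mod x)
    go zero    x = tp-real x , λ _ a∈ → tp-atoms x (cn-cl a∈)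
    go (suc k) x .real = tp-real x
    go (suc k) x .lits _ a∈ = tp-atoms x (cn-cl a∈)
    go (suc k) x .box {y = y} r∈ e = tp mod y , tp-compat e , go k y
    go (suc k) x .dia r∈ d∈ = let y , e , p = tp-succ x d∈ in y , e , tp mod y , tp-compat e , p , go k y

  -- Unravelling

  module _ (J : Interp) where

    -- copy k x w is the point x with k levels of J still to be copied; once
    -- these are exhausted, and along roles outside Σ, the unravelling continues
    -- in the canonical model of all realisable types.
    data Unravelled : Type → Set where
      copy : ∀ k x {t} → W J k x t → Unravelled t
      free : ∀ {t} → t ∈ types → Unravelled t

    Unravelled-real : ∀ {t} → Unravelled t → t ∈ types
    Unravelled-real (copy k _ w) = W-real k w
    Unravelled-real (free p)     = p

    data URole (r : RName) : ∃ Unravelled → ∃ Unravelled → Set where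
      down : ∀ {k x y t t′} {w : W J (suc k) x t} {w′ : W J k y t′} →
             r ∈ rn → role J r x y → Compatible r t t′ →
             URole r (t , copy (suc k) x w) (t′ , copy k y w′)
      exit : ∀ {t t′} {u : Unravelled t} {p : t′ ∈ types} →
             ¬ r ∈ rn → Compatible r t t′ → URole r (t , u) (t′ , free p)
      end  : ∀ {x t t′} {w : W J 0 x t} {p : t′ ∈ types} →
             Compatible r t t′ → URole r (t , copy 0 x w) (t′ , free p)
      stay : ∀ {t t′} {p : t ∈ types} {p′ : t′ ∈ types} →
             Compatible r t t′ → URole r (t , free p) (t′ , free p′)

    unravelling : ∃ Unravelled → Interp
    unravelling u = record
      { Δ = ∃ Unravelled ; pt = u ; conc = λ a (t , _) → atom a ∈ t ; role = URole }

    unravelling-typing : ∀ u₀ → Typing (unravelling u₀)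
    unravelling-typing u₀ = record
      { τ = proj₁ ; real = λ (_ , u) → Unravelled-real u ; atoms = λ _ _ → mk⇔ id id
      ; compat = compatible ; succ = λ (_ , u) p → successor u p }
      where
      compatible : ∀ {r t t′ u u′} → URole r (t , u) (t′ , u′) → Compatible r t t′
      compatible (down _ _ c) = c
      compatible (exit _ c)   = c
      compatible (end c)      = c
      compatible (stay c)     = c
      successor : ∀ {r d t} (u : Unravelled t) → ex r d ∈ t → ∃ λ v → URole r (t , u) v × Eval (proj₁ v) d
      successor {r} u p with em {r ∈ rn} | types-witness (Unravelled-real u) p
      successor u p                | no r∉ | t′ , t′∈ , c , v = (t′ , free t′∈) , exit r∉ c , v
      successor (free _) p         | yes _ | t′ , t′∈ , c , v = (t′ , free t′∈) , stay c , v
      successor (copy 0 x w) p     | yes _ | t′ , t′∈ , c , v = (t′ , free t′∈) , end c , v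
      successor (copy (suc k) x w) p | yes r∈ | _ =
        let y , e , t′ , c , v , w′ = dia w r∈ p in (t′ , copy k y w′) , down r∈ e c , v

    -- A Σ-concept of depth at most `k` cannot look past the `k` copied levels. Within them, `box`
    -- finds a copy of each Σ-edge of `J`, and each Σ-edge comes from `J` by `down`.
    unravelling-ext : ∀ u₀ c → ConceptOver S c → ∀ k → depth c ≤ k → ∀ {x t} (w : W J k x t) →
      ext J c x ⇔ ext (unravelling u₀) c (t , copy k x w)
    unravelling-ext u₀ top       o k l w = mk⇔ id id
    unravelling-ext u₀ (atom a)  o k l w = W-lits k w a o
    unravelling-ext u₀ (neg c)   o k l w =
      let e = unravelling-ext u₀ c o k l w in mk⇔ (_∘ from e) (_∘ to e)
    unravelling-ext u₀ (and c d) (o , o′) k l w =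
      let e = unravelling-ext u₀ c o k (m⊔n≤o⇒m≤o (depth c) (depth d) l) w
          f = unravelling-ext u₀ d o′ k (m⊔n≤o⇒n≤o (depth c) (depth d) l) w
      in mk⇔ (λ (p , q) → to e p , to f q) (λ (p , q) → from e p , from f q)
    unravelling-ext u₀ (ex r c) (r∈ , o) (suc k) (s≤s l) {x} {t} w = mk⇔ forwards backwards
      where
      forwards : ext J (ex r c) x → ext (unravelling u₀) (ex r c) (t , copy (suc k) x w)
      forwards (y , e , p) = let t′ , c′ , w′ = box w r∈ e in
        (t′ , copy k y w′) , down r∈ e c′ , to (unravelling-ext u₀ c o k l w′) p
      backwards : ext (unravelling u₀) (ex r c) (t , copy (suc k) x w) → ext J (ex r c) x
      backwards ((t′ , copy _ y w′) , down _ e _ , p) = y , e , from (unravelling-ext u₀ c o k l w′) p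
      backwards ((_ , free _) , exit r∉ _ , _) = ⊥-elim (r∉ r∈)

  -- The unravelling of `J` at `x` is a model of `T`; truth of `c` is carried into it and truth of
  -- `d` back.
  entailed-holds : ∀ {J k c d} → ConceptOver S c → ConceptOver S d → depth c ≤ k → depth d ≤ k →
    Entails T (c ⊑ d) → Satisfies J k → SatCI J (c ⊑ d)
  entailed-holds {J} {k} {c} {d} oc od lc ld ent sat x p =
    let t , w = sat x
        u     = t , copy k x w
    in from (unravelling-ext J u d od k ld w)
         (ent (unravelling J u) (typing-model (unravelling-typing J u)) u
           (to (unravelling-ext J u c oc k lc w) p))

  -- The concepts χ

  ⋀ : List Concept → Concept
  ⋀ []       = top
  ⋀ (c ∷ cs) = and c (⋀ cs)

  ⋁ : List Concept → Concept
  ⋁ cs = neg (⋀ (map neg cs))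

  ∀r : RName → Concept → Concept
  ∀r r c = neg (ex r (neg c))

  when : Set → Concept → Concept
  when P c with em {P}
  ... | yes _ = c
  ... | no _  = top

  literal : Type → Concept → Concept
  literal t (atom a) = and (when (a ∈ cn × atom a ∈ t) (atom a))
                           (when (a ∈ cn × ¬ atom a ∈ t) (neg (atom a)))
  literal t _        = top

  -- The conjuncts of `χ` are indexed by members of `cl` rather than by names, so that sizes depend
  -- on `length cl` alone. The value restriction for `r` is attached to every `ex r d` in `cl`.
  restriction : (Type → Concept) → Type → Concept → Concept
  restriction χ t (ex r d) =
    and (when (r ∈ rn) (∀r r (⋁ (map χ (keep (Compatible r t) types)))))
        (when (r ∈ rn × ex r d ∈ t)
          (ex r (⋁ (map χ (keep (λ t′ → Compatible r t t′ × Eval t′ d) types)))))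
  restriction χ t _        = top

  χ : ℕ → Type → Concept
  χ zero    t = ⋀ (map (literal t) cl)
  χ (suc k) t = ⋀ (map (λ d → and (literal t d) (restriction (χ k) t d)) cl)

  module _ {I : Interp} where

    ext-⋀ : ∀ {A : Set} (f : A → Concept) as {x} → ext I (⋀ (map f as)) x ⇔ (∀ {a} → a ∈ as → ext I (f a) x)
    ext-⋀ f []       = mk⇔ (λ _ ()) (λ _ → tt)
    ext-⋀ f (a ∷ as) = mk⇔
      (λ { (p , q) (here refl) → p ; (p , q) (there a∈) → to (ext-⋀ f as) q a∈ })
      (λ h → h (here refl) , from (ext-⋀ f as) (λ p → h (there p)))

    ext-⋁ : ∀ {A : Set} (f : A → Concept) as {x} →
      ext I (⋁ (map f as)) x ⇔ (∃ λ a → a ∈ as × ext I (f a) x)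
    ext-⋁ f as {x} = mk⇔
      (λ ¬all → byContradiction λ none → ¬all (from all¬ λ a∈ p → none (_ , a∈ , p)))
      (λ (a , a∈ , p) all → to all¬ all a∈ p)
      where
      all¬ : ext I (⋀ (map neg (map f as))) x ⇔ (∀ {a} → a ∈ as → ¬ ext I (f a) x)
      all¬ = subst (λ cs → ext I (⋀ cs) x ⇔ (∀ {a} → a ∈ as → ¬ ext I (f a) x)) 
        (map-∘ as) (ext-⋀ (neg ∘ f) as)

    ext-when : ∀ P {c x} → ext I (when P c) x ⇔ (P → ext I c x)
    ext-when P with em {P}
    ... | yes p = mk⇔ (λ q _ → q) (λ f → f p)
    ... | no ¬p = mk⇔ (λ _ p → ⊥-elim (¬p p)) (λ _ → tt)

    ext-∀r : ∀ {r} c {x} → ext I (∀r r c) x ⇔ (∀ {y} → role I r x y → ext I c y)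
    ext-∀r c = mk⇔ (λ h {y} e → byContradiction λ ¬p → h (y , e , ¬p)) (λ h (y , e , ¬p) → ¬p (h e))

    ext-literals : ∀ {t x} → (∀ d → d ∈ cl → ext I (literal t d) x) ⇔ Literals I x t
    ext-literals {t} {x} = mk⇔
      (λ h a a∈ → mk⇔
        (λ p → byContradiction λ a∉t → to (ext-when _) (proj₂ (h (atom a) (cn-cl a∈))) (a∈ , a∉t) p)
        (λ a∈t → to (ext-when _) (proj₁ (h (atom a) (cn-cl a∈))) (a∈ , a∈t)))
      (λ l d _ → literals l d)
      where
      literals : Literals I x t → ∀ d → ext I (literal t d) x
      literals l top       = tt
      literals l (atom a)  = from (ext-when _) (λ (a∈ , a∈t) → from (l a a∈) a∈t)
                           , from (ext-when _) (λ (a∈ , a∉t) → a∉t ∘ to (l a a∈))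
      literals l (neg _)   = tt
      literals l (and _ _) = tt
      literals l (ex _ _)  = tt

    ext-χ : ∀ k {t x} → t ∈ types → ext I (χ k t) x ⇔ W I k x t
    ext-χ zero    {t} t∈ = mk⇔ (λ p → t∈ , to ext-literals (λ _ → to (ext-⋀ _ cl) p))
                               (λ (_ , l) → from (ext-⋀ (literal t) cl) (λ {d} → from ext-literals l d))
    ext-χ (suc k) {t} {x} t∈ = mk⇔ forwards backwards
      where
      forwards : ext I (χ (suc k) t) x → W I (suc k) x t
      forwards p = step t∈ (to ext-literals λ _ d∈ → proj₁ (h d∈)) box′ dia′
        where
        h : ∀ {d} → d ∈ cl → ext I (and (literal t d) (restriction (χ k) t d)) x
        h = to (ext-⋀ _ cl) p
        box′ : ∀ {r y} → r ∈ rn → role I r x y → ∃ λ t′ → Compatible r t t′ × W I k y t′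
        box′ {r} r∈ e =
          -- Some existential over `r` must be picked, since the value restriction for `r` is stored
          -- at such members of `cl`.
          let d , d∈       = rn-cl r∈
              t′ , t′∈ , q = to (ext-⋁ (χ k) _)
                (to (ext-∀r (⋁ (map (χ k) (keep (Compatible r t) types))))
                  (to (ext-when _) (proj₁ (proj₂ (h d∈))) r∈) e)
              t′∈′ , c     = keep⁻ (Compatible r t) {types} t′∈
          in t′ , c , to (ext-χ k t′∈′) q
        dia′ : ∀ {r d} → r ∈ rn → ex r d ∈ t →
          ∃ λ y → role I r x y × ∃ λ t′ → Compatible r t t′ × Eval t′ d × W I k y t′
        dia′ {r} {d} r∈ d∈ =
          let y , e , q         = to (ext-when _) (proj₂ (proj₂ (h (types-⊆ t∈ d∈)))) (r∈ , d∈)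
              t′ , t′∈ , q′     = to (ext-⋁ (χ k) _) q
              t′∈′ , c , v      = keep⁻ (λ t′ → Compatible r t t′ × Eval t′ d) {types} t′∈
          in y , e , t′ , c , v , to (ext-χ k t′∈′) q′
      backwards : W I (suc k) x t → ext I (χ (suc k) t) x
      backwards w = from (ext-⋀ _ cl) λ {d} d∈ → from ext-literals (lits w) d d∈ , restrictions d
        where
        restrictions : ∀ d → ext I (restriction (χ k) t d) x
        restrictions top       = tt
        restrictions (atom _)  = tt
        restrictions (neg _)   = tt
        restrictions (and _ _) = tt
        restrictions (ex r d)  =
            from (ext-when _) (λ r∈ → from (ext-∀r (⋁ (map (χ k) (keep (Compatible r t) types)))) λ e →
              let t′ , c , w′ = box w r∈ e
                  t′∈         = W-real k w′
              in from (ext-⋁ (χ k) _) (t′ , keep⁺ (Compatible r t) t′∈ c , from (ext-χ k t′∈) w′))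
          , from (ext-when _) (λ (r∈ , d∈) →
              let y , e , t′ , c , v , w′ = dia w r∈ d∈
                  t′∈                     = W-real k w′
              in y , e , from (ext-⋁ (χ k) _)
                   (t′ , keep⁺ (λ t′ → Compatible r t t′ × Eval t′ d) t′∈ (c , v) , from (ext-χ k t′∈) w′))

  ⋀-over : ∀ {A : Set} (f : A → Concept) as → (∀ a → ConceptOver S (f a)) → ConceptOver S (⋀ (map f as))
  ⋀-over f []       o = tt
  ⋀-over f (a ∷ as) o = o a , ⋀-over f as o

  ⋁-over : ∀ {A : Set} (f : A → Concept) as → (∀ a → ConceptOver S (f a)) → ConceptOver S (⋁ (map f as))
  ⋁-over f []       o = tt
  ⋁-over f (a ∷ as) o = o a , ⋁-over f as o

  when-over : ∀ P {c} → (P → ConceptOver S c) → ConceptOver S (when P c)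
  when-over P o with em {P}
  ... | yes p = o p
  ... | no _  = tt

  literal-over : ∀ t d → ConceptOver S (literal t d)
  literal-over t top       = tt
  literal-over t (atom a)  = when-over _ proj₁ , when-over _ proj₁
  literal-over t (neg _)   = tt
  literal-over t (and _ _) = tt
  literal-over t (ex _ _)  = tt

  restriction-over : ∀ ξ → (∀ t → ConceptOver S (ξ t)) → ∀ t d → ConceptOver S (restriction ξ t d)
  restriction-over ξ o t top       = tt
  restriction-over ξ o t (atom _)  = tt
  restriction-over ξ o t (neg _)   = tt
  restriction-over ξ o t (and _ _) = tt
  restriction-over ξ o t (ex r d)  = when-over _ (λ r∈ → r∈ , ⋁-over ξ (keep (Compatible r t) types) o)
                                 , when-over _ (λ (r∈ , _) →
      r∈ , ⋁-over ξ (keep (λ t′ → Compatible r t t′ × Eval t′ d) types) o)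

  χ-over : ∀ k t → ConceptOver S (χ k t)
  χ-over zero    t = ⋀-over _ cl (literal-over t)
  χ-over (suc k) t = ⋀-over _ cl λ d → literal-over t d , restriction-over (χ k) (χ-over k) t d

  -- The approximating TBoxes.

  approximation : ℕ → TBox
  approximation k = (top ⊑ ⋁ (map (χ k) types)) ∷ []

  approximation-over : ∀ k → TBoxOver S (approximation k)
  approximation-over k = (tt , ⋁-over (χ k) types (χ-over k)) All.∷ All.[]

  approximation-holds : ∀ {I} k → SatCI I (top ⊑ ⋁ (map (χ k) types)) ⇔ Satisfies I k
  approximation-holds k = mk⇔
    (λ h x → let t , t∈ , p = to (ext-⋁ (χ k) types) (h x tt) in t , to (ext-χ k t∈) p)
    (λ sat x _ → let t , w = sat x ; t∈ = W-real k w in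
      from (ext-⋁ (χ k) types) (t , t∈ , from (ext-χ k t∈) w))

  -- Finite trees and their types

  children : Tree → List (RName × Tree)
  children (leaf t)    = map (λ (r , t′) → r , leaf t′)
                             (keep (λ (r , t′) → Compatible r t t′) (cartesianProduct rn types))
  children (node _ cs) = cs

  -- All trees are points of one interpretation, so `W`, `B` and `Ext` of different trees can be
  -- compared there.
  𝕋 : Interp
  𝕋 = record { Δ = Tree ; pt = leaf [] ; conc = λ a x → atom a ∈ label x
             ; role = λ r x y → (r , y) ∈ children x }

  Ext : Tree → Type → Set
  Ext x t = ∀ k → W 𝕋 k x t

  Ext-real : ∀ {x t} → Ext x t → t ∈ types
  Ext-real E = proj₁ (E 0)

  Ext-leaf : ∀ {t} → t ∈ types → Ext (leaf t) t
  Ext-leaf t∈ zero    = t∈ , λ _ _ → mk⇔ id id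
  Ext-leaf t∈ (suc k) .real = t∈
  Ext-leaf t∈ (suc k) .lits _ _ = mk⇔ id id
  Ext-leaf {t} t∈ (suc k) .box r∈ e with ∈-map⁻ (λ (r , t′) → r , leaf t′) e
  ... | (r , t′) , p , refl =
    let p′ , c = keep⁻ (λ (r , t′) → Compatible r t t′) {cartesianProduct rn types} p
    in t′ , c , Ext-leaf (proj₂ (∈-cartesianProduct⁻ rn types p′)) k
  Ext-leaf {t} t∈ (suc k) .dia {r} r∈ d∈ =
    let t′ , t′∈ , c , v = types-witness t∈ d∈
    in leaf t′
     , ∈-map⁺ (λ (r , t′) → r , leaf t′)
         (keep⁺ (λ (r , t′) → Compatible r t t′) (∈-cartesianProduct⁺ r∈ t′∈) c)
     , t′ , c , v , Ext-leaf t′∈ k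

  -- Finite branching is what lets the intersection over all depths commute with Step.
  Ext-step : ∀ {x t} → Ext x t ⇔ Step 𝕋 Ext x t
  Ext-step {x} {t} = mk⇔ forwards backwards
    where
    forwards : Ext x t → Step 𝕋 Ext x t
    forwards E =
      let m , f = antitone-stabilises (λ { k ((r , y) , t) → W 𝕋 k y t }) W-anti
                    (cartesianProduct (children x) types)
      in Step-match Match-refl
           (λ { (refl , r , _ , e) w → f (∈-cartesianProduct⁺ e (W-real m w)) w }) (E (suc m))
    backwards : Step 𝕋 Ext x t → Ext x t
    backwards s zero    = real s , lits s
    backwards s (suc k) = Step-match Match-refl (λ { (refl , _) E → E k }) s

  -- Refining bounded bisimilarity without changing `Ext`.

  infix 4 _≈_
  _≈_ : Tree → Tree → Set
  x ≈ y = ∀ t → Ext x t ⇔ Ext y t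

  -- By `Ext-step`, `Ext` at a tree depends only on its Σ-names and on `Ext` at its Σ-successors.
  Match-≈ : ∀ {x y} → Match 𝕋 𝕋 _≈_ x y → x ≈ y
  Match-≈ m t = mk⇔
    (from Ext-step ∘ Step-match m (λ {_} {_} {t′} e → to (e t′)) ∘ to Ext-step)
    (from Ext-step ∘ Step-match (Match-sym m) (λ {_} {_} {t′} e → from (e t′)) ∘ to Ext-step)

  Good : Tree → Set
  Good x = ∀ {y} → Star (Edge 𝕋) x y → ∃ (Ext y)

  -- Separated from `Good` for trees whose root is still to be given a type.
  GoodBelow : Tree → Set
  GoodBelow x = ∀ {y} → Edge 𝕋 x y → Good y

  good : ∀ {x} → GoodBelow x → ∃ (Ext x) → Good x
  good g E ε       = E
  good g E (e ◅ p) = g e p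

  good-below : ∀ {x} → Good x → GoodBelow x
  good-below g e p = g (e ◅ p)

  good-leaf : ∀ {t} → t ∈ types → Good (leaf t)
  good-leaf {t} t∈ ε = t , Ext-leaf t∈
  good-leaf {t} t∈ ((r , r∈ , e) ◅ p) with ∈-map⁻ (λ (r , t′) → r , leaf t′) e
  ... | (_ , t′) , q , refl =
    good-leaf (proj₂ (∈-cartesianProduct⁻ rn types
      (proj₁ (keep⁻ (λ (r , t′) → Compatible r t t′) {cartesianProduct rn types} q)))) p

  Refined : ℕ → Tree → Tree → Tree → Tree → Set
  Refined n x y x′ y′ = Good x′ × Good y′ × x ≈ x′ × y ≈ y′ × B 𝕋 𝕋 n x′ y′

  -- Q m n says that the pairs (Ext x , Ext y) coming from m-bisimilar good
  -- trees already come from n-bisimilar ones.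
  Q : ℕ → ℕ → Set
  Q m n = ∀ {x y} → Good x → Good y → B 𝕋 𝕋 m x y → ∃₂ (Refined n x y)

  -- Every `m`-bisimilar pair of children under a common Σ-role is replaced by a refined pair, and
  -- new roots are put over the left and the right halves. Since `x` and `y` are bisimilar to depth
  -- `suc m`, each Σ-child occurs in some pair, so `Match-≈` preserves `Ext` at the roots; the pairs
  -- themselves give back and forth to depth `suc n`.
  refine-children : ∀ {m n x y} → Q m n → GoodBelow x → GoodBelow y → B 𝕋 𝕋 (suc m) x y →
    ∃₂ λ x′ y′ → GoodBelow x′ × GoodBelow y′ × x ≈ x′ × y ≈ y′ × B 𝕋 𝕋 (suc n) x′ y′
  refine-children {m} {n} {x} {y} q gx gy b =
    x′ , y′ , gx′ , gy′ , Match-≈ x-match , Match-≈ y-match , x′y′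
    where
    Entry : Set
    Entry = (RName × Tree) × (RName × Tree)
    P : Entry → Set
    P ((r , c) , (s , d)) = r ≡ s × r ∈ rn × B 𝕋 𝕋 m c d
    R : Entry → RName × Tree × Tree → Set
    R ((r , c) , (s , d)) (r′ , c′ , d′) = r ≡ r′ × Refined n c d c′ d′
    pairs : List Entry
    pairs = cartesianProduct (children x) (children y)
    refine : ∀ {a} → a ∈ pairs → P a → ∃ (R a)
    refine a∈ (refl , r∈ , bcd) =
      let e , f            = ∈-cartesianProduct⁻ (children x) (children y) a∈
          c′ , d′ , refined = q (gx (_ , r∈ , e)) (gy (_ , r∈ , f)) bcd
      in (_ , c′ , d′) , refl , refined
    collected = collect P R pairs refine
    zs : List (RName × Tree × Tree)
    zs = proj₁ collected
    left right : RName × Tree × Tree → RName × Tree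
    left  (r , c , d) = r , c
    right (r , c , d) = r , d
    x′ y′ : Tree
    x′ = node (label x) (map left zs)
    y′ = node (label y) (map right zs)
    cover : ∀ {r c d} → r ∈ rn → (r , c) ∈ children x → (r , d) ∈ children y → B 𝕋 𝕋 m c d →
      ∃₂ λ c′ d′ → (r , c′ , d′) ∈ zs × Refined n c d c′ d′
    cover r∈ e f bcd with proj₁ (proj₂ collected) (∈-cartesianProduct⁺ e f) (refl , r∈ , bcd)
    ... | (_ , c′ , d′) , z∈ , refl , refined = c′ , d′ , z∈ , refined
    origin : ∀ {r c′ d′} → (r , c′ , d′) ∈ zs →
      ∃₂ λ c d → (r , c) ∈ children x × (r , d) ∈ children y × Refined n c d c′ d′
    origin z∈ with proj₂ (proj₂ collected) z∈
    ... | ((_ , c) , (_ , d)) , a∈ , (refl , _) , refl , refined =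
      let e , f = ∈-cartesianProduct⁻ (children x) (children y) a∈ in c , d , e , f , refined
    gx′ : GoodBelow x′
    gx′ (r , _ , e) with ∈-map⁻ left e
    ... | _ , z∈ , refl = let _ , _ , _ , _ , g , _ = origin z∈ in g
    gy′ : GoodBelow y′
    gy′ (r , _ , e) with ∈-map⁻ right e
    ... | _ , z∈ , refl = let _ , _ , _ , _ , _ , g , _ = origin z∈ in g
    x-match : Match 𝕋 𝕋 _≈_ x x′
    x-match .same _ = mk⇔ id id
    x-match .forth r∈ e =
      let d , f , bcd                      = forth b r∈ e
          c′ , d′ , z∈ , _ , _ , c≈c′ , _ = cover r∈ e f bcd
      in c′ , ∈-map⁺ left z∈ , c≈c′
    x-match .back r∈ e with ∈-map⁻ left e
    ... | _ , z∈ , refl = let c , d , e′ , _ , _ , _ , c≈c′ , _ = origin z∈ in c , e′ , c≈c′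
    y-match : Match 𝕋 𝕋 _≈_ y y′
    y-match .same _ = mk⇔ id id
    y-match .forth r∈ f =
      let c , e , bcd                          = back b r∈ f
          c′ , d′ , z∈ , _ , _ , _ , d≈d′ , _ = cover r∈ e f bcd
      in d′ , ∈-map⁺ right z∈ , d≈d′
    y-match .back r∈ e with ∈-map⁻ right e
    ... | _ , z∈ , refl = let c , d , _ , f , _ , _ , _ , d≈d′ , _ = origin z∈ in d , f , d≈d′
    x′y′ : B 𝕋 𝕋 (suc n) x′ y′
    x′y′ .same = same b
    x′y′ .forth r∈ e with ∈-map⁻ left e
    ... | (_ , c′ , d′) , z∈ , refl =
      let _ , _ , _ , _ , _ , _ , _ , _ , bcd = origin z∈ in d′ , ∈-map⁺ right z∈ , bcd
    x′y′ .back r∈ e with ∈-map⁻ right e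
    ... | (_ , c′ , d′) , z∈ , refl =
      let _ , _ , _ , _ , _ , _ , _ , _ , bcd = origin z∈ in c′ , ∈-map⁺ left z∈ , bcd

  Ext-≈ : ∀ {x y} → x ≈ y → ∃ (Ext x) → ∃ (Ext y)
  Ext-≈ x≈y (t , E) = t , to (x≈y t) E

  Q-suc : ∀ {m n} → Q m n → Q (suc m) (suc n)
  Q-suc q gx gy b =
    let x′ , y′ , gx′ , gy′ , x≈ , y≈ , b′ = refine-children q (good-below gx) (good-below gy) b
    in x′ , y′ , good gx′ (Ext-≈ x≈ (gx ε)) , good gy′ (Ext-≈ y≈ (gy ε)) , x≈ , y≈ , b′

  Q-trans : ∀ {l m n} → Q l m → Q m n → Q l n
  Q-trans p q gx gy b =
    let x′ , y′ , gx′ , gy′ , x≈ , y≈ , b′      = p gx gy b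
        x″ , y″ , gx″ , gy″ , x′≈ , y′≈ , b″ = q gx′ gy′ b′
    in x″ , y″ , gx″ , gy″ , (λ t → x≈ t ⇔∘ x′≈ t) , (λ t → y≈ t ⇔∘ y′≈ t) , b″

  -- `Q-suc` shifts a single stable step upwards, and `Q-trans` chains the shifted steps.
  Q-stable : ∀ {m} → Q m (suc m) → ∀ k → Q m (k + m)
  Q-stable q zero    gx gy b = _ , _ , gx , gy , (λ _ → mk⇔ id id) , (λ _ → mk⇔ id id) , b
  Q-stable {m} q (suc k) = Q-trans (Q-stable q k) (shift k)
    where
    shift : ∀ k → Q (k + m) (suc (k + m))
    shift zero    = q
    shift (suc k) = Q-suc (shift k)

  codes : List (List Type × List Type)
  codes = cartesianProduct (sublists types) (sublists types)

  Stuck : ℕ → Set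
  Stuck m = ∃₂ λ x y → Good x × Good y × B 𝕋 𝕋 m x y × ¬ ∃₂ (Refined (suc m) x y)

  -- The pairs (Ext x , Ext y) realised at level m form a decreasing sequence of
  -- subsets of a set of size length codes.
  Q-stabilises : ∃ λ m → m ≤ length codes × Q m (suc m)
  Q-stabilises with em {∃ λ m → m ≤ length codes × ¬ Stuck m}
  ... | yes (m , m≤ , unstuck) = m , m≤ , λ gx gy b →
    byContradiction λ none → unstuck (_ , _ , gx , gy , b , none)
  -- If every level is stuck, two levels `i < j` carry the same pair of codes. The pair found at `j`
  -- is bisimilar to depth `suc i` because of `i<j`, so it refines the pair found at `i`.
  ... | no none = ⊥-elim (proj₂ (proj₂ (proj₂ (proj₂ (proj₂ (stuck i)))))
      (x j , x′ j , gx j , gx′ j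
        , code-≈ (cong proj₁ same-code) , code-≈ (cong proj₂ same-code) , B-anti i<j (bis j)))
    where
    stuck : ∀ (i : Fin (suc (length codes))) → Stuck (toℕ i)
    stuck i = byContradiction λ ¬s → none (toℕ i , toℕ≤pred[n] i , ¬s)
    x x′ : Fin (suc (length codes)) → Tree
    x i  = proj₁ (stuck i)
    x′ i = proj₁ (proj₂ (stuck i))
    gx : ∀ i → Good (x i)
    gx i = proj₁ (proj₂ (proj₂ (stuck i)))
    gx′ : ∀ i → Good (x′ i)
    gx′ i = proj₁ (proj₂ (proj₂ (proj₂ (stuck i))))
    bis : ∀ i → B 𝕋 𝕋 (toℕ i) (x i) (x′ i)
    bis i = proj₁ (proj₂ (proj₂ (proj₂ (proj₂ (stuck i)))))
    code : Tree → List Type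
    code y = keep (Ext y) types
    code-≈ : ∀ {y z} → code y ≡ code z → y ≈ z
    code-≈ {y} {z} e t = mk⇔ (transfer {y} {z} e) (transfer {z} {y} (sym e))
      where
      transfer : ∀ {y z} → code y ≡ code z → Ext y t → Ext z t
      transfer {y} {z} e E =
        proj₂ (keep⁻ (Ext z) {types} (subst (t ∈_) e (keep⁺ (Ext y) (Ext-real {y} E) E)))
    collision = pigeonhole-∈ codes (λ i → code (x i) , code (x′ i))
      (λ i → ∈-cartesianProduct⁺ (keep-∈-sublists _ types) (keep-∈-sublists _ types))
    i j : Fin (suc (length codes))
    i = proj₁ collision
    j = proj₁ (proj₂ collision)
    i<j : toℕ i < toℕ j
    i<j = proj₁ (proj₂ (proj₂ collision))
    same-code : (code (x i) , code (x′ i)) ≡ (code (x j) , code (x′ j))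
    same-code = proj₂ (proj₂ (proj₂ collision))

  -- Σ-generated subinterpretations.

  generated : (J : Interp) → Δ J → Interp
  generated J x = record
    { Δ = Σ (Δ J) (Star (Edge J) x) ; pt = x , ε
    ; conc = λ a (y , _) → conc J a y ; role = λ r (y , _) (z , _) → role J r y z }

  generated-match : ∀ {J x} y → Match (generated J x) J (λ (z , _) z′ → z ≡ z′) y (proj₁ y)
  generated-match y .same _ = mk⇔ id id
  generated-match y .forth r∈ e = _ , e , refl
  generated-match (y , p) .back r∈ e = (_ , p ◅◅ ((_ , r∈ , e) ◅ ε)) , e , refl

  generated-W : ∀ {J x} k y {t} → W (generated J x) k y t ⇔ W J k (proj₁ y) t
  generated-W zero    y = mk⇔ id id
  generated-W (suc k) y = mk⇔
    (Step-match (generated-match y) (λ { {z} refl → to (generated-W k z) }))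
    (Step-match (Match-sym (generated-match y)) (λ { {_} {z} refl → from (generated-W k z) }))

  -- Completeness over finitely branching interpretations.

  module Stable {M} (stable : Q M (suc M))
                N (complete : ∀ J → Satisfies J N → ∀ k → Satisfies J k) where

    -- Localises `complete`: only points Σ-reachable from `x` survive in the generated
    -- subinterpretation.
    complete-at : ∀ {J x} → (∀ {y} → Star (Edge J) x y → ∃ (W J N y)) → ∀ k → ∃ (W J k x)
    complete-at {J} {x} h k =
      let t , w = complete (generated J x)
                    (λ (y , p) → let t , w = h p in t , from (generated-W N (y , p)) w) k (x , ε)
      in t , to (generated-W k (x , ε)) w

    -- The sets `W 𝕋 k x` decrease within the finite list `types`, so a type present at the
    -- stabilisation level stays forever.
    Ext-nonempty : ∀ {x} → (∀ k → ∃ (W 𝕋 k x)) → ∃ (Ext x)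
    Ext-nonempty {x} h =
      let m , f = antitone-stabilises (λ k t → W 𝕋 k x t) W-anti types
          t , w = h m
      in t , f (W-real m w) w

    -- The critical level M suffices to transfer nonemptiness of Ext, because
    -- the pair can be replaced by one that is bisimilar up to depth N.
    bisimilar-nonempty : ∀ {x y} → Good x → GoodBelow y → B 𝕋 𝕋 (suc M) x y → ∃ (Ext y)
    bisimilar-nonempty gx gy b =
      let x′ , y′ , _ , gy′ , x≈ , y≈ , b′ =
            refine-children (Q-stable stable N) (good-below gx) gy b
          t , E = Ext-≈ x≈ (gx ε)
          w     = W-anti (m≤n⇒m≤1+n (m≤m+n N M)) (B-W (suc (N + M)) b′ (E (suc (N + M))))
          -- Depth `N` is covered everywhere: at the root `y′` by the type moved over from `x′`,
          -- below it by goodness.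
          t′ , E′ = Ext-nonempty (complete-at
                      λ { ε → t , w ; (e ◅ p) → let t , E = gy′ e p in t , E N })
      in t′ , from (y≈ t′) E′

    module _ (J : Interp)
             (branch : ∀ x → ∃ λ (ys : List (RName × Δ J)) →
               ∀ {r y} → (r , y) ∈ ys ⇔ (r ∈ rn × role J r x y))
             (sat : Satisfies J (suc M)) where

      good-copy : ∀ k {x t} → W J k x t → ∃ λ y → Good y × Ext y t × B 𝕋 J k y x
      good-copy zero    {x} {t} (t∈ , l) =
        leaf t , good-leaf t∈ , Ext-leaf t∈ , λ a∈ → ⇔-sym (l _ a∈)
      good-copy (suc k) {x} {t} w =
        node t cs , good below (t , ext′) , ext′ , bis
        where
        ys = proj₁ (branch x)
        ys⇔ = proj₂ (branch x)
        P : (RName × Δ J) × Type → Set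
        P ((r , y) , t′) = Compatible r t t′ × W J k y t′
        R : (RName × Δ J) × Type → RName × Tree → Set
        R ((r , y) , t′) (r′ , c) = r ≡ r′ × Good c × Ext c t′ × B 𝕋 J k c y
        collected = collect P R (cartesianProduct ys types)
          λ _ (_ , w′) → let c , p = good-copy k w′ in (_ , c) , refl , p
        cs = proj₁ collected
        cover : ∀ {r y t′} → r ∈ rn → role J r x y → Compatible r t t′ → W J k y t′ →
          ∃ λ c → (r , c) ∈ cs × Ext c t′ × B 𝕋 J k c y
        cover r∈ e c w′ with proj₁ (proj₂ collected)
          (∈-cartesianProduct⁺ (from ys⇔ (r∈ , e)) (W-real k w′)) (c , w′)
        ... | (_ , d) , d∈ , refl , _ , E , b = d , d∈ , E , b
        origin : ∀ {r c} → (r , c) ∈ cs →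
          ∃₂ λ y t′ → role J r x y × Compatible r t t′ × Good c × Ext c t′ × B 𝕋 J k c y
        origin c∈ with proj₂ (proj₂ collected) c∈
        ... | ((_ , y) , t′) , a∈ , (c , _) , refl , g , E , b =
          y , t′ , proj₂ (to ys⇔ (proj₁ (∈-cartesianProduct⁻ ys types a∈))) , c , g , E , b
        below : GoodBelow (node t cs)
        below (_ , _ , c∈) = let _ , _ , _ , _ , g , _ = origin c∈ in g
        ext′ : Ext (node t cs) t
        ext′ = from Ext-step (step (real w) (λ _ _ → mk⇔ id id)
          (λ _ c∈ → let _ , t′ , _ , c , _ , E , _ = origin c∈ in t′ , c , E)
          (λ r∈ d∈ → let y , e , t′ , c , v , w′ = dia w r∈ d∈
                         d , d∈′ , E , _         = cover r∈ e c w′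
                     in d , d∈′ , t′ , c , v , E))
        bis : B 𝕋 J (suc k) (node t cs) x
        bis .same a∈ = ⇔-sym (lits w _ a∈)
        bis .forth r∈ c∈ = let y , _ , e , _ , _ , _ , b = origin c∈ in y , e , b
        bis .back r∈ e =
          let t′ , c , w′    = box w r∈ e
              d , d∈ , _ , b = cover r∈ e c w′
          in d , d∈ , b

      -- Induction on `k`, with approximations for `k` as children of a new root `z`. To see that
      -- `Ext z` is inhabited, `z` is compared with the good copy of `x` to depth `suc M`: both are
      -- bisimilar to `x` to that depth, so `bisimilar-nonempty` applies.
      good-approximation : ∀ k x → ∃ λ y → Good y × (∀ {t} → Ext y t → W J k x t) × B 𝕋 J (suc M) y x
      good-approximation zero    x =
        let t , w         = sat x
            y , g , _ , b = good-copy (suc M) w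
        in y , g , (λ E → W-anti z≤n (B-W (suc M) b (E (suc M)))) , b
      good-approximation (suc k) x = z , good below (bisimilar-nonempty gy below (B-join (suc M) by bz))
                                   , below-W , bz
        where
        t = proj₁ (sat x)
        ys = proj₁ (branch x)
        ys⇔ = proj₂ (branch x)
        R : RName × Δ J → RName × Tree → Set
        R (r , y) (r′ , c) = r ≡ r′ × Good c × (∀ {t} → Ext c t → W J k y t) × B 𝕋 J (suc M) c y
        collected = collect (λ _ → ⊤) R ys
          λ {(r , y)} _ _ → let c , p = good-approximation k y in (r , c) , refl , p
        cs = proj₁ collected
        z : Tree
        -- The label `t` only fixes the Σ-names at the root; the member of `Ext z` found later may
        -- be another type.
        z = node t cs
        origin : ∀ {r c} → (r , c) ∈ cs → ∃ λ y → role J r x y × Good c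
          × (∀ {t} → Ext c t → W J k y t) × B 𝕋 J (suc M) c y
        origin c∈ with proj₂ (proj₂ collected) c∈
        ... | (_ , y) , y∈ , _ , refl , p = y , proj₂ (to ys⇔ y∈) , p
        below : GoodBelow z
        below (_ , _ , c∈) = let _ , _ , g , _ = origin c∈ in g
        z-match : Match 𝕋 J (λ c y → (∀ {t} → Ext c t → W J k y t) × B 𝕋 J (suc M) c y) z x
        z-match .same a∈ = ⇔-sym (W-lits (suc M) (proj₂ (sat x)) _ a∈)
        z-match .forth r∈ c∈ = let y , e , _ , p = origin c∈ in y , e , p
        z-match .back r∈ e with proj₁ (proj₂ collected) (from ys⇔ (r∈ , e)) tt
        ... | (_ , c) , c∈ , refl , _ , p = c , c∈ , p
        bz : B 𝕋 J (suc M) z x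
        -- Children bisimilar to depth `suc M` give the root one level more, which is dropped to
        -- keep the invariant.
        bz = B-pred (suc M) (Match-mono proj₂ z-match)
        below-W : ∀ {t} → Ext z t → W J (suc k) x t
        below-W E = Step-match z-match (λ (f , _) → f) (to Ext-step E)
        y = proj₁ (good-copy (suc M) (proj₂ (sat x)))
        gy : Good y
        gy = proj₁ (proj₂ (good-copy (suc M) (proj₂ (sat x))))
        by : B 𝕋 J (suc M) y x
        by = proj₂ (proj₂ (proj₂ (good-copy (suc M) (proj₂ (sat x)))))

      satisfies-all : ∀ k → Satisfies J k
      satisfies-all k x =
        let y , g , f , _ = good-approximation k x
            t , E         = g ε
        in t , f E

  -- Reduction to finite branching.

  module Redirected (J : Interp) (K : ℕ) where

    indices : List (ℕ × Type)
    indices = cartesianProduct (upTo (suc K)) types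

    profile : ℕ × Type → Δ J → Set
    profile (k , t) x = W J k x t

    reps : ∃ λ vs → ∀ {x} → ⊤ → ∃ λ v → v ∈ vs × ⊤ × (∀ {i} → i ∈ indices → profile i x ⇔ profile i v)
    reps = representatives profile indices (λ _ → ⊤)

    vs : List (Δ J)
    vs = proj₁ reps

    Alike : Δ J → Δ J → Set
    Alike x v = ∀ i → i ∈ indices → profile i x ⇔ profile i v

    -- Every edge is redirected to a representative of its target, so that each
    -- point has finitely many successors.
    redirected : Interp
    redirected = record
      { Δ = Δ J ; pt = pt J ; conc = conc J
      ; role = λ r x v → v ∈ vs × ∃ λ y → role J r x y × Alike y v }

    redirected-match : ∀ {x} → Match J redirected Alike x x
    redirected-match .same _ = mk⇔ id id
    redirected-match .forth {x′ = y} r∈ e =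
      let v , v∈ , _ , alike = proj₂ reps tt
      in v , (v∈ , y , e , λ _ → alike) , λ _ → alike
    redirected-match .back r∈ (v∈ , y , e , alike) = y , e , alike

    -- `Step` at level `suc k` consults successors at level `k`, and a representative agrees with
    -- the original target at all levels up to `K`.
    redirected-W : ∀ k → k ≤ K → ∀ {x t} → W J k x t ⇔ W redirected k x t
    redirected-W zero    k≤K = mk⇔ id id
    redirected-W (suc k) k<K = mk⇔
      (Step-match redirected-match λ alike w →
        to (redirected-W k k≤K) (to (alike _ (index (W-real k w))) w))
      (Step-match (Match-sym redirected-match) λ alike w →
        from (alike _ (index (W-real k w))) (from (redirected-W k k≤K) w))
      where
      k≤K = <⇒≤ k<K
      index : ∀ {t} → t ∈ types → (k , t) ∈ indices
      index t∈ = ∈-cartesianProduct⁺ (∈-upTo⁺ (m≤n⇒m≤1+n k<K)) t∈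

    redirected-branch : ∀ x → ∃ λ (ys : List (RName × Δ J)) →
      ∀ {r y} → (r , y) ∈ ys ⇔ (r ∈ rn × role redirected r x y)
    redirected-branch x = keep Successor (cartesianProduct rn vs) , mk⇔
      (λ p → let a∈ , e = keep⁻ Successor {cartesianProduct rn vs} p
             in proj₁ (∈-cartesianProduct⁻ rn vs a∈) , e)
      (λ (r∈ , e) → keep⁺ Successor (∈-cartesianProduct⁺ r∈ (proj₁ e)) e)
      where
      Successor : RName × Δ J → Set
      Successor (r , y) = role redirected r x y

  -- The critical approximation as an interpolant.

  module _ {M} (stable : Q M (suc M)) N (complete : ∀ J → Satisfies J N → ∀ k → Satisfies J k) where

    approximation-complete : ∀ J → Satisfies J (suc M) → ∀ k → Satisfies J k
    approximation-complete J sat k x =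
      let t , w = Stable.satisfies-all stable N complete redirected redirected-branch
                    (λ x → let t , w = sat x in t , to (redirected-W (suc M) (m≤n⊔m k (suc M))) w) k x
      in t , from (redirected-W k (m≤m⊔n k (suc M))) w
      -- Redirection must preserve both the depth assumed, `suc M`, and the depth wanted, `k`.
      where open Redirected J (k ⊔ suc M)

  -- The axioms of `T₀` are Σ-consequences of `T` of depth at most `depthT T₀`, so `J` is a model of
  -- `T₀`. As `T` entails every approximation, so does `T₀`, and they all hold in `J`.
  interpolant-complete : ∀ {T₀} → UniformInterpolant S T T₀ →
    ∀ J → Satisfies J (depthT T₀) → ∀ k → Satisfies J k
  interpolant-complete {T₀} (over , interpolates) J sat k =
    to (approximation-holds k) (to (interpolates top (⋁ (map (χ k) types)) tt χ∈) T-entails J T₀-model)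
    where
    χ∈ : ConceptOver S (⋁ (map (χ k) types))
    χ∈ = ⋁-over (χ k) types (χ-over k)
    T-entails : Entails T (top ⊑ ⋁ (map (χ k) types))
    T-entails I mod = from (approximation-holds k) (model-satisfies mod k)
    T₀-model : Model J T₀
    T₀-model = All.tabulate λ { {c ⊑ d} i∈ →
      let oc , od = All.lookup over i∈
          lc , ld = depthT-∈ T₀ i∈
      in entailed-holds {c = c} {d} oc od lc ld (from (interpolates c d oc od) (λ I mod → All.lookup mod i∈)) sat }

  approximation-interpolates : ∀ {k T₀} → UniformInterpolant S T T₀ →
    (∀ J → Satisfies J k → ∀ n → Satisfies J n) → UniformInterpolant S T (approximation k)
  approximation-interpolates {k} {T₀} (over , interpolates) complete = approximation-over k ,
    λ c d oc od → mk⇔ (forwards c d oc od) (backwards c d)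
    where
    forwards : ∀ c d → ConceptOver S c → ConceptOver S d →
      Entails T (c ⊑ d) → Entails (approximation k) (c ⊑ d)
    forwards c d oc od ent J (h All.∷ _) =
      entailed-holds {c = c} {d} oc od (m≤m⊔n (depth c) (depth d)) (m≤n⊔m (depth c) (depth d)) ent
        (complete J (to (approximation-holds k) h) (depth c ⊔ depth d))
    backwards : ∀ c d → Entails (approximation k) (c ⊑ d) → Entails T (c ⊑ d)
    backwards c d ent I mod = ent I (from (approximation-holds k) (model-satisfies mod k) All.∷ All.[])

  -- Size bounds

  sizeC-positive : ∀ c → 1 ≤ sizeC c
  sizeC-positive top       = s≤s z≤n
  sizeC-positive (atom _)  = s≤s z≤n
  sizeC-positive (neg _)   = s≤s z≤n
  sizeC-positive (and _ _) = s≤s z≤n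
  sizeC-positive (ex _ _)  = s≤s z≤n

  size-⋀ : ∀ {A : Set} {b} (f : A → Concept) as → (∀ {a} → a ∈ as → sizeC (f a) ≤ b) →
    sizeC (⋀ (map f as)) ≤ 1 + length as * (1 + b)
  size-⋀ f []       h = ≤-refl
  size-⋀ {b = b} f (a ∷ as) h = s≤s (begin
    sizeC (f a) + sizeC (⋀ (map f as))     ≤⟨ +-mono-≤ (h (here refl)) (size-⋀ f as (h ∘ there)) ⟩
    b + (1 + length as * (1 + b))          ≡⟨ +-suc b _ ⟩
    1 + b + length as * (1 + b)            ∎)
    where open ≤-Reasoning

  size-⋁ : ∀ {A : Set} {b} (f : A → Concept) as → (∀ {a} → a ∈ as → sizeC (f a) ≤ b) →
    sizeC (⋁ (map f as)) ≤ 2 + length as * (2 + b)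
  size-⋁ f as h = s≤s (subst (λ cs → sizeC (⋀ cs) ≤ _) (map-∘ as) (size-⋀ (neg ∘ f) as (s≤s ∘ h)))

  size-when : ∀ P c → sizeC (when P c) ≤ sizeC c
  size-when P c with em {P}
  ... | yes _ = ≤-refl
  ... | no _  = sizeC-positive c

  size-literal : ∀ t d → sizeC (literal t d) ≤ 4
  size-literal t top       = s≤s z≤n
  size-literal t (atom a)  = s≤s (+-mono-≤ (size-when _ (atom a)) (size-when _ (neg (atom a))))
  size-literal t (neg _)   = s≤s z≤n
  size-literal t (and _ _) = s≤s z≤n
  size-literal t (ex _ _)  = s≤s z≤n

  n u : ℕ
  n = length cl
  u = 2 ^ n

  length-types : length types ≤ u
  length-types = ≤-trans (length-filter _ (sublists cl)) (≤-reflexive (length-sublists cl))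

  size-restriction : ∀ ξ b → (∀ t → sizeC (ξ t) ≤ b) → ∀ t d →
    sizeC (restriction ξ t d) ≤ 11 + 2 * (u * (2 + b))
  size-restriction ξ b h t top       = s≤s z≤n
  size-restriction ξ b h t (atom _)  = s≤s z≤n
  size-restriction ξ b h t (neg _)   = s≤s z≤n
  size-restriction ξ b h t (and _ _) = s≤s z≤n
  size-restriction ξ b h t (ex r d)  = s≤s (begin
    sizeC (when (r ∈ rn) (∀r r (⋁ (map ξ (keep (Compatible r t) types)))))
      + sizeC (when (r ∈ rn × ex r d ∈ t) (ex r (⋁ (map ξ (keep Eligible types)))))
      ≤⟨ +-mono-≤ (size-when _ _) (size-when _ _) ⟩
    4 + sizeC (⋁ (map ξ (keep (Compatible r t) types))) + (2 + sizeC (⋁ (map ξ (keep Eligible types))))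
      ≤⟨ +-mono-≤ (+-monoʳ-≤ 4 (bound _)) (+-monoʳ-≤ 2 (bound _)) ⟩
    4 + (2 + X) + (2 + (2 + X))
      ≡⟨ solve 1 (λ x → con 4 :+ (con 2 :+ x) :+ (con 2 :+ (con 2 :+ x)) := con 10 :+ con 2 :* x) refl X ⟩
    10 + 2 * X ∎)
    where
    open ≤-Reasoning
    open +-*-Solver
    X : ℕ
    X = u * (2 + b)
    Eligible : Type → Set
    Eligible t′ = Compatible r t t′ × Eval t′ d
    bound : ∀ P → sizeC (⋁ (map ξ (keep P types))) ≤ 2 + X
    bound P = ≤-trans (size-⋁ ξ (keep P types) (λ {a} _ → h a))
      (+-monoʳ-≤ 2 (*-monoˡ-≤ (2 + b) (≤-trans (length-filter _ types) length-types)))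

  -- The growth factor per level of `χ`. The constant 32 absorbs the symbols of one level and keeps
  -- `base` a power of two.
  base : ℕ
  base = u * (32 * u)

  1≤u : 1 ≤ u
  1≤u = m^n>0 2 n

  suc-n≤u : suc n ≤ u
  suc-n≤u = go n
    where
    go : ∀ m → suc m ≤ 2 ^ m
    go zero    = ≤-refl
    go (suc m) = begin
      suc (suc m)           ≤⟨ s≤s (go m) ⟩
      1 + 2 ^ m             ≤⟨ +-monoˡ-≤ (2 ^ m) (m^n>0 2 m) ⟩
      2 ^ m + 2 ^ m         ≡⟨ cong (2 ^ m +_) (sym (+-identityʳ (2 ^ m))) ⟩
      2 ^ suc m             ∎
      where open ≤-Reasoning

  -- Adding 2 to both sides turns the affine recurrence of `sizeχ` into a geometric one.
  step-bound : ∀ b → 3 + n * (17 + 2 * (u * (2 + b))) ≤ (2 + b) * base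
  step-bound b = begin
    3 + n * (17 + 2 * (u * (2 + b)))
      ≤⟨ +-mono-≤ (m≤m*n 3 X) (*-monoʳ-≤ n (+-monoˡ-≤ (2 * X) (m≤m*n 17 X))) ⟩
    3 * X + n * (17 * X + 2 * X)
      ≤⟨ m≤m+n _ (29 * X + 13 * (n * X)) ⟩
    3 * X + n * (17 * X + 2 * X) + (29 * X + 13 * (n * X))
      ≡⟨ solve 2 (λ n x → con 3 :* x :+ n :* (con 17 :* x :+ con 2 :* x) :+ (con 29 :* x :+ con 13 :* (n :* x))
                        := (con 32 :* (con 1 :+ n)) :* x) refl n X ⟩
    32 * suc n * X
      ≤⟨ *-monoˡ-≤ X (*-monoʳ-≤ 32 suc-n≤u) ⟩
    32 * u * (u * (2 + b))
      ≡⟨ solve 2 (λ u b → con 32 :* u :* (u :* b) := b :* (u :* (con 32 :* u))) refl u (2 + b) ⟩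
    (2 + b) * base ∎
    where
    open ≤-Reasoning
    open +-*-Solver
    X : ℕ
    X = u * (2 + b)
    instance
      X-nonzero : NonZero X
      X-nonzero = >-nonZero (*-mono-≤ 1≤u (s≤s (z≤n {suc b})))

  sizeχ : ℕ → ℕ
  sizeχ zero    = 1 + n * 5
  -- 17 is 4 for the literal, 11 for the constant part of the restriction, and 1 for each of the two
  -- conjunctions.
  sizeχ (suc k) = 1 + n * (17 + 2 * (u * (2 + sizeχ k)))

  size-χ : ∀ k t → sizeC (χ k t) ≤ sizeχ k
  size-χ zero    t = size-⋀ (literal t) cl λ {d} _ → size-literal t d
  size-χ (suc k) t = size-⋀ _ cl λ {d} _ →
    s≤s (+-mono-≤ (size-literal t d) (size-restriction (χ k) (sizeχ k) (size-χ k) t d))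

  sizeχ-bound : ∀ k → 2 + sizeχ k ≤ base ^ suc k
  sizeχ-bound zero = begin
    3 + n * 5                     ≤⟨ m≤m+n _ (29 + n * 27) ⟩
    3 + n * 5 + (29 + n * 27)     ≡⟨ solve 1 (λ n → con 3 :+ n :* con 5 :+ (con 29 :+ n :* con 27)
                                                 := con 1 :* (con 32 :* (con 1 :+ n))) refl n ⟩
    1 * (32 * suc n)              ≤⟨ *-mono-≤ 1≤u (*-monoʳ-≤ 32 suc-n≤u) ⟩
    base                          ≡⟨ sym (*-identityʳ base) ⟩
    base ^ 1                      ∎
    where
    open ≤-Reasoning
    open +-*-Solver
  sizeχ-bound (suc k) = begin
    3 + n * (17 + 2 * (u * (2 + sizeχ k)))   ≤⟨ step-bound (sizeχ k) ⟩
    (2 + sizeχ k) * base                     ≤⟨ *-monoˡ-≤ base (sizeχ-bound k) ⟩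
    base ^ suc k * base                      ≡⟨ *-comm (base ^ suc k) base ⟩
    base ^ suc (suc k)                       ∎
    where open ≤-Reasoning

  size-approximation : ∀ k → sizeT (approximation k) ≤ base ^ suc (suc k)
  size-approximation k = begin
    suc (suc (sizeC (⋁ (map (χ k) types)))) + 0
      ≡⟨ +-identityʳ _ ⟩
    2 + sizeC (⋁ (map (χ k) types))
      ≤⟨ +-monoʳ-≤ 2 (size-⋁ (χ k) types (λ {t} _ → size-χ k t)) ⟩
    4 + length types * X
      ≤⟨ +-mono-≤ (*-mono-≤ {4} {4} ≤-refl (*-mono-≤ 1≤u 1≤X)) (*-monoˡ-≤ X length-types) ⟩
    4 * (u * X) + u * X
      ≡⟨ solve 2 (λ u x → con 4 :* (u :* x) :+ u :* x := u :* con 5 :* x) refl u X ⟩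
    u * 5 * X
      ≤⟨ *-monoˡ-≤ X (*-monoʳ-≤ u (*-mono-≤ {5} {32} (m≤m+n 5 27) 1≤u)) ⟩
    base * X
      ≤⟨ *-monoʳ-≤ base (sizeχ-bound k) ⟩
    base ^ suc (suc k) ∎
    where
    open ≤-Reasoning
    open +-*-Solver
    X : ℕ
    X = 2 + sizeχ k
    1≤X : 1 ≤ X
    1≤X = s≤s z≤n

  length-codes : length codes ≤ 2 ^ (u + u)
  length-codes = begin
    length codes                                        ≡⟨ length-cartesianProduct (sublists types) _ ⟩
    length (sublists types) * length (sublists types)   ≤⟨ *-mono-≤ code≤ code≤ ⟩
    2 ^ u * 2 ^ u                                       ≡⟨ sym (^-distribˡ-+-* 2 u u) ⟩
    2 ^ (u + u)                                         ∎
    where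
    open ≤-Reasoning
    code≤ : length (sublists types) ≤ 2 ^ u
    code≤ = ≤-trans (≤-reflexive (length-sublists types)) (^-monoʳ-≤ 2 length-types)

  base-power : base ≡ 2 ^ (n + (5 + n))
  base-power = sym (trans (^-distribˡ-+-* 2 n (5 + n)) (cong (u *_) (^-distribˡ-+-* 2 5 n)))

  -- `base` is 2 to a power linear in `n`, and `M` is at most `2 ^ (u + u)` with `u = 2 ^ n`. The
  -- product of the two exponents is below 2 to a power that is at most `8 * u`.
  triple-exponential : ∀ M → M ≤ length codes → base ^ (3 + M) ≤ 2 ^ (2 ^ (2 ^ (3 + n)))
  triple-exponential M M≤ = begin
    base ^ (3 + M)                          ≡⟨ cong (_^ (3 + M)) base-power ⟩
    (2 ^ (n + (5 + n))) ^ (3 + M)           ≡⟨ ^-*-assoc 2 (n + (5 + n)) (3 + M) ⟩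
    2 ^ ((n + (5 + n)) * (3 + M))           ≤⟨ ^-monoʳ-≤ 2 (*-mono-≤ exponent≤ height≤) ⟩
    2 ^ (2 ^ (3 + n) * 2 ^ (2 + (u + u)))   ≡⟨ cong (2 ^_) (sym (^-distribˡ-+-* 2 (3 + n) (2 + (u + u)))) ⟩
    2 ^ (2 ^ (3 + n + (2 + (u + u))))       ≤⟨ ^-monoʳ-≤ 2 (^-monoʳ-≤ 2 total≤) ⟩
    2 ^ (2 ^ (2 ^ (3 + n)))                 ∎
    where
    open ≤-Reasoning
    open +-*-Solver
    exponent≤ : n + (5 + n) ≤ 2 ^ (3 + n)
    exponent≤ = begin
      n + (5 + n)                     ≤⟨ m≤m+n _ (3 + 6 * n) ⟩
      n + (5 + n) + (3 + 6 * n)       ≡⟨ solve 1 (λ n → n :+ (con 5 :+ n) :+ (con 3 :+ con 6 :* n)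
                                                       := con 8 :* (con 1 :+ n)) refl n ⟩
      8 * suc n                       ≤⟨ *-monoʳ-≤ 8 suc-n≤u ⟩
      8 * u                           ≡⟨ sym (^-distribˡ-+-* 2 3 n) ⟩
      2 ^ (3 + n)                     ∎
    height≤ : 3 + M ≤ 2 ^ (2 + (u + u))
    height≤ = begin
      3 + M                           ≤⟨ +-mono-≤ (*-mono-≤ {3} {3} ≤-refl (m^n>0 2 (u + u))) (≤-trans M≤ length-codes) ⟩
      3 * 2 ^ (u + u) + 2 ^ (u + u)   ≡⟨ solve 1 (λ x → con 3 :* x :+ x := con 4 :* x) refl (2 ^ (u + u)) ⟩
      4 * 2 ^ (u + u)                 ≡⟨ sym (^-distribˡ-+-* 2 2 (u + u)) ⟩
      2 ^ (2 + (u + u))               ∎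
    total≤ : 3 + n + (2 + (u + u)) ≤ 2 ^ (3 + n)
    total≤ = begin
      3 + n + (2 + (u + u))                  ≤⟨ m≤m+n _ (5 * n + 1) ⟩
      3 + n + (2 + (u + u)) + (5 * n + 1)    ≡⟨ solve 2 (λ n u → con 3 :+ n :+ (con 2 :+ (u :+ u)) :+ (con 5 :* n :+ con 1)
                                                       := con 6 :* (con 1 :+ n) :+ con 2 :* u) refl n u ⟩
      6 * suc n + 2 * u                      ≤⟨ +-monoˡ-≤ (2 * u) (*-monoʳ-≤ 6 suc-n≤u) ⟩
      6 * u + 2 * u                          ≡⟨ solve 1 (λ u → con 6 :* u :+ con 2 :* u := con 8 :* u) refl u ⟩
      8 * u                                  ≡⟨ sym (^-distribˡ-+-* 2 3 n) ⟩
      2 ^ (3 + n)                            ∎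

  -- Assembling the interpolant and its size bound.

  interpolant : (∃ λ T₀ → UniformInterpolant S T T₀) →
    ∃ λ T′ → UniformInterpolant S T T′ × sizeT T′ ≤ 2 ^ (2 ^ (2 ^ (3 + n)))
  interpolant (T₀ , interpolates) =
    let M , M≤ , stable = Q-stabilises
    in approximation (suc M)
     , approximation-interpolates {suc M} interpolates
         (approximation-complete stable (depthT T₀) (interpolant-complete interpolates))
     , ≤-trans (size-approximation (suc M)) (triple-exponential M M≤)

theorem11 : ExcludedMiddle 0ℓ →
    Σ Poly λ p → (t : TBox) (s : Sig) → SigSub s t →
    (∃ λ t' → UniformInterpolant s t t') →
    ∃ λ t' → UniformInterpolant s t t' × sizeT t' ≤ 2 ^ (2 ^ (2 ^ evalP p (sizeT t)))
-- The polynomial is `3 + x`, because `length (modalsT t)` is at most `sizeT t`.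
theorem11 em = 3 ∷ 1 ∷ [] , λ t s sig interpolable →
  let t' , interpolates , size = Unfolding.interpolant em t s sig interpolable
      n                        = sizeT t
      exponent : 3 + length (modalsT t) ≤ 3 + n * (1 + n * 0)
      exponent = +-monoʳ-≤ 3 (≤-trans (length-modalsT t) (m≤m*n n (1 + n * 0)))
  in t' , interpolates
   , ≤-trans size (^-monoʳ-≤ 2 (^-monoʳ-≤ 2 (^-monoʳ-≤ 2 exponent)))
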